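{- Let $n\ge2$ with $n\equiv 2$ or $3\pmod 4$. Then the number of equiparity Latin squares in the ensemble of any $\mathrm{OA}(n+1,n)$ is congruent to $\lceil n/4\rceil$ modulo $4$.
   Context: An orthogonal array $\mathrm{OA}(k,n)$ on an alphabet $\Lambda$ with $|\Lambda|=n$ is an $n^2\times k$ matrix $A=(a_{r\ell})$ with entries in $\Lambda$ such that in every pair of distinct columns each ordered pair in $\Lambda^2$ occurs in exactly one row. The ensemble of $A$ is the family of Latin squares indexed by the $\binom{k}{3}$ choices of columns $i<j<\ell$ of $A$ (Latin squares are counted once for each choice of three columns): the Latin square for $i<j<\ell$ has rows and columns indexed by $\Lambda$, and for each row $r$ of $A$ its entry in row $a_{ri}$, column $a_{rj}$ is $a_{r\ell}$. For a Latin square $L=(l_{xy})$ with rows, columns and symbols indexed by $\Lambda$, the row-parity $\pi_r\in\mathbb{Z}_2$ is the sum of the parities ($0$ even, $1$ odd) of the $n$ permutations $y\mapsto l_{xy}$ ($x\in\Lambda$ fixed); the column-parity $\pi_c$ is the sum of the parities of the $n$ permutations $x\mapsto l_{xy}$ ($y$ fixed); the symbol-parity $\pi_s$ is the sum of the parities of the $n$ permutations mapping $x\mapsto y$ whenever $l_{xy}=s$ ($s$ fixed). $L$ is equiparity if $\pi_r=\pi_c=\pi_s$. -}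

module Defs where

open import Data.Fin.Base using (Fin; _<_)
open import Data.Fin.Permutation using (Permutation′; _⟨$⟩ʳ_; _⟨$⟩ˡ_)
open import Data.Fin.Properties using (_<?_; <⇒≢; <-trans)
open import Data.Integer.Base as ℤ using (ℤ; +_)
import Data.Integer.Divisibility as ℤ∣
open import Data.List.Base
  using (List; allFin; cartesianProduct; filter; length; map; mapMaybe)
open import Data.Maybe.Base as Maybe using (Maybe)
open import Data.Nat.Base as ℕ using (ℕ; _^_)
open import Data.Parity.Base using (Parity)
import Data.Parity.Properties as ℙ
open import Data.Product using (_×_; _,_; proj₁; proj₂; ∃!)
open import Function.Base using (_∘_)
open import Function.Bundles using (_↔_; mk↔ₛ′; Inverse)
open import Function.Construct.Composition using (_↔-∘_)
open import Function.Construct.Symmetry using (↔-sym)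
open import Level using (Level)
open import Relation.Binary.PropositionalEquality.Core
  using (_≡_; _≢_; refl; sym; trans; cong)
open import Relation.Nullary.Decidable using (Dec; dec⇒maybe; _×-dec_)
open import Algebra.Properties.CommutativeMonoid.Sum ℙ.+-0-commutativeMonoid
  using (sum)

private
  variable
    a : Level
    k n : ℕ
    Λ : Set a

infix 4 _≡_[mod_]

_≡_[mod_] : ℤ → ℤ → ℕ → Set
x ≡ y [mod m ] = + m ℤ∣.∣ (x ℤ.- y)

------------------------------------------------------------------------
-- Parity of permutations

inversions : Permutation′ n → List (Fin n × Fin n)
inversions {n} π =
  filter (λ (i , j) → i <? j ×-dec (π ⟨$⟩ʳ j) <? (π ⟨$⟩ʳ i))
         (cartesianProduct (allFin n) (allFin n))

parity : Permutation′ n → Parity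
parity π = ℕ.parity (length (inversions π))

-- A finite set Λ of size n is given with an enumeration e : Λ ↔ Fin n, along
-- which a permutation of Λ is transported to Fin n. Another choice of e
-- conjugates the transported permutation, so the parity is independent of e.

parityOn : Λ ↔ Fin n → Λ ↔ Λ → Parity
parityOn e σ = parity ((e ↔-∘ σ) ↔-∘ ↔-sym e)

sumOver : Λ ↔ Fin n → (Λ → Parity) → Parity
sumOver e f = sum (λ i → f (Inverse.from e i))

------------------------------------------------------------------------
-- Latin squares

record LatinSquare (Λ : Set a) : Set a where
  field
    entry      : Λ → Λ → Λ
    row-latin  : ∀ x s → ∃! _≡_ λ y → entry x y ≡ s
    col-latin  : ∀ y s → ∃! _≡_ λ x → entry x y ≡ s

  columnOf : Λ → Λ → Λ
  columnOf x s = proj₁ (row-latin x s)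

  rowOf : Λ → Λ → Λ
  rowOf y s = proj₁ (col-latin y s)

  rowPerm : Λ → Λ ↔ Λ
  rowPerm x = mk↔ₛ′ (entry x) (columnOf x)
    (λ s → proj₁ (proj₂ (row-latin x s)))
    (λ y → proj₂ (proj₂ (row-latin x (entry x y))) refl)

  colPerm : Λ → Λ ↔ Λ
  colPerm y = mk↔ₛ′ (λ x → entry x y) (rowOf y)
    (λ s → proj₁ (proj₂ (col-latin y s)))
    (λ x → proj₂ (proj₂ (col-latin y (entry x y))) refl)

  -- Sends x to the unique y with entry x y ≡ s.
  symPerm : Λ → Λ ↔ Λ
  symPerm s = mk↔ₛ′ (λ x → columnOf x s) (λ y → rowOf y s)
    (λ y → proj₂ (proj₂ (row-latin (rowOf y s) s))
                 (proj₁ (proj₂ (col-latin y s))))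
    (λ x → proj₂ (proj₂ (col-latin (columnOf x s) s))
                 (proj₁ (proj₂ (row-latin x s))))

module _ (e : Λ ↔ Fin n) (L : LatinSquare Λ) where
  open LatinSquare L

  rowParity colParity symParity : Parity
  rowParity = sumOver e (λ x → parityOn e (rowPerm x))
  colParity = sumOver e (λ y → parityOn e (colPerm y))
  symParity = sumOver e (λ s → parityOn e (symPerm s))

  Equiparity : Set
  Equiparity = rowParity ≡ colParity × colParity ≡ symParity

  equiparity? : Dec Equiparity
  equiparity? = rowParity ℙ.≟ colParity ×-dec colParity ℙ.≟ symParity

------------------------------------------------------------------------
-- Orthogonal arrays

-- That Λ has exactly n elements is a separate hypothesis, Λ ↔ Fin n.

record OrthogonalArray (k n : ℕ) (Λ : Set a) : Set a where
  field
    at         : Fin (n ^ 2) → Fin k → Λ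
    orthogonal : ∀ {i j} → i ≢ j → ∀ x y →
                 ∃! _≡_ λ r → at r i ≡ x × at r j ≡ y

record Triple (k : ℕ) : Set where
  constructor triple
  field
    i j ℓ : Fin k
    i<j   : i < j
    j<ℓ   : j < ℓ

triple? : Fin k × Fin k × Fin k → Maybe (Triple k)
triple? (i , j , ℓ) =
  Maybe.map (λ (i<j , j<ℓ) → triple i j ℓ i<j j<ℓ)
            (dec⇒maybe (i <? j ×-dec j <? ℓ))

-- Every choice of columns i < j < ℓ occurs exactly once.
triples : ∀ k → List (Triple k)
triples k =
  mapMaybe triple?
    (cartesianProduct (allFin k) (cartesianProduct (allFin k) (allFin k)))

module _ {Λ : Set a} (A : OrthogonalArray k n Λ) where
  open OrthogonalArray A

  latinSquare : Triple k → LatinSquare Λ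
  latinSquare (triple i j ℓ i<j j<ℓ) = record
    { entry     = λ x y → at (row i≢j x y) ℓ
    ; row-latin = λ x s → let r = row i≢ℓ x s in
        at r j
      , trans (cong (λ q → at q ℓ) (row-unique i≢j (fst i≢ℓ x s) refl))
              (snd i≢ℓ x s)
      , λ {y} ey → trans
          (cong (λ q → at q j) (row-unique i≢ℓ (fst i≢j x y) ey))
          (snd i≢j x y)
    ; col-latin = λ y s → let r = row j≢ℓ y s in
        at r i
      , trans (cong (λ q → at q ℓ) (row-unique i≢j refl (fst j≢ℓ y s)))
              (snd j≢ℓ y s)
      , λ {x} ex → trans
          (cong (λ q → at q i) (row-unique j≢ℓ (snd i≢j x y) ex))
          (fst i≢j x y)
    }
    where
    i≢j : i ≢ j
    i≢j = <⇒≢ i<j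

    j≢ℓ : j ≢ ℓ
    j≢ℓ = <⇒≢ j<ℓ

    i≢ℓ : i ≢ ℓ
    i≢ℓ = <⇒≢ (<-trans i<j j<ℓ)

    row : ∀ {p q} → p ≢ q → Λ → Λ → Fin (n ^ 2)
    row p≢q x y = proj₁ (orthogonal p≢q x y)

    fst : ∀ {p q} (p≢q : p ≢ q) x y → at (row p≢q x y) p ≡ x
    fst p≢q x y = proj₁ (proj₁ (proj₂ (orthogonal p≢q x y)))

    snd : ∀ {p q} (p≢q : p ≢ q) x y → at (row p≢q x y) q ≡ y
    snd p≢q x y = proj₂ (proj₁ (proj₂ (orthogonal p≢q x y)))

    row-unique : ∀ {p q} (p≢q : p ≢ q) {x y r} →
                 at r p ≡ x → at r q ≡ y → row p≢q x y ≡ r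
    row-unique p≢q {x} {y} ep eq =
      proj₂ (proj₂ (orthogonal p≢q x y)) (ep , eq)

  ensemble : List (LatinSquare Λ)
  ensemble = map latinSquare (triples k)

  equiparityCount : Λ ↔ Fin n → ℕ
  equiparityCount e = length (filter (equiparity? e) ensemble)

{-# OPTIONS --safe #-}

-- Sorting the rows of the array lexicographically by two columns i and j is a
-- permutation of n² rows, of parity t i j. Exchanging i and j composes it with
-- the transposition of an n × n array, which is odd for n ≡ 2, 3 (mod 4), so t
-- is a tournament on the n + 1 columns. The parities of the Latin square on the
-- columns i, j, l are the sums t i j + t i l, t j i + t j l and t l i + t l j,
-- so it is equiparity iff i, j, l is a cyclic triangle. Any two rows agree in
-- exactly one column, which makes all indegrees congruent modulo 2; reversing
-- the tournament if necessary, they are all odd. The number E of cyclic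
-- triangles is C(n+1,3) − ∑ C(d,2) over the indegrees d, and d² ≡ 1 (mod 8)
-- determines E modulo 4.

module Submission where

open import Defs
open import Algebra.Bundles using (CommutativeSemiring)
open import Data.Bool.Base using (Bool; true; false; if_then_else_; _∧_)
open import Data.Empty using (⊥-elim)
open import Data.Fin.Base using (Fin; zero; suc; toℕ; _<_; punchOut)
open import Data.Fin.Permutation using (Permutation′; _⟨$⟩ʳ_)
import Data.Fin.Properties as Fin
open import Data.Integer.Base as ℤ using (+_)
import Data.Integer.Divisibility.Signed as ℤ
import Data.Integer.Properties as ℤ
import Data.Integer.Tactic.RingSolver as ℤ
open import Data.Nat.Divisibility using (divides)
open import Data.Nat.DivMod using ([m+kn]%n≡m%n; +-distrib-/-∣ʳ; m*n/n≡m)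
open import Data.List.Base
  using ([]; _∷_; _++_; allFin; cartesianProduct; filter; length; map; mapMaybe; tabulate)
import Data.List.Properties as List using (map-++; map-∘)
open import Data.Maybe.Base as Maybe using (Maybe; just; nothing; maybe′)
open import Data.Nat.Base as ℕ using (ℕ; zero; suc; _+_; _≤_; _^_)
import Data.Nat.ListAction as List
import Data.Nat.ListAction.Properties as List
import Data.Nat.Properties as ℕ
open import Data.Nat.Tactic.RingSolver using (solve-∀)
open import Data.Parity.Base as ℙ using (Parity; 0ℙ; 1ℙ)
import Data.Parity.Properties as ℙ
open import Data.Product using (_×_; _,_; proj₁; proj₂; ∃)
open import Data.Rational.Unnormalised.Base using (_/_; ceiling)
open import Data.Sum.Base using (_⊎_; inj₁; inj₂)
open import Function.Base using (_∘_; flip; id)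
open import Function.Bundles using (_↔_; Inverse)
open import Function.Construct.Composition using (_↔-∘_)
open import Function.Construct.Symmetry using (↔-sym)
open import Function.Definitions using (Injective)
open import Relation.Binary.PropositionalEquality
  using (_≡_; _≢_; refl; sym; trans; cong; cong₂; subst; module ≡-Reasoning)
open import Relation.Nullary.Decidable using (Dec; yes; no; does; dec⇒maybe; _×-dec_)

private
  variable
    k m n N : ℕ

-- Boolean comparison on `Fin n`

infix 4 _<ᵇ_ _≡ᵇ_

_<ᵇ_ _≡ᵇ_ : Fin n → Fin n → Bool
x <ᵇ y = toℕ x ℕ.<ᵇ toℕ y
x ≡ᵇ y = toℕ x ℕ.≡ᵇ toℕ y

-- Indexing by all three Booleans lets a single `with` on `compare` evaluate every indicator built
-- from `x` and `y`.
data Comparison (x y : Fin n) : Bool → Bool → Bool → Set where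
  lt : x < y → Comparison x y true  false false
  eq : x ≡ y → Comparison x y false true  false
  gt : y < x → Comparison x y false false true

compare : ∀ (x y : Fin n) → Comparison x y (x <ᵇ y) (x ≡ᵇ y) (y <ᵇ x)
compare zero    zero    = eq refl
compare zero    (suc y) = lt ℕ.z<s
compare (suc x) zero    = gt ℕ.z<s
compare (suc x) (suc y)
  with x <ᵇ y | x ≡ᵇ y | y <ᵇ x | compare x y
... | _ | _ | _ | lt x<y = lt (ℕ.s<s x<y)
... | _ | _ | _ | eq x≡y = eq (cong suc x≡y)
... | _ | _ | _ | gt y<x = gt (ℕ.s<s y<x)

≡ᵇ-refl : ∀ (x : Fin n) → (x ≡ᵇ x) ≡ true
≡ᵇ-refl zero    = refl
≡ᵇ-refl (suc x) = ≡ᵇ-refl x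

<ᵇ-irrefl : ∀ (x : Fin n) → (x <ᵇ x) ≡ false
<ᵇ-irrefl zero    = refl
<ᵇ-irrefl (suc x) = <ᵇ-irrefl x

≢⇒≡ᵇ-false : ∀ (x y : Fin n) → x ≢ y → (x ≡ᵇ y) ≡ false
≢⇒≡ᵇ-false x y x≢y
  with x <ᵇ y | x ≡ᵇ y | y <ᵇ x | compare x y
... | _ | _ | _ | lt _   = refl
... | _ | _ | _ | eq x≡y = ⊥-elim (x≢y x≡y)
... | _ | _ | _ | gt _   = refl

≡ᵇ-cong-⇔ : ∀ {x y : Fin m} {u v : Fin n} →
            (x ≡ y → u ≡ v) → (u ≡ v → x ≡ y) → (x ≡ᵇ y) ≡ (u ≡ᵇ v)
≡ᵇ-cong-⇔ {x = x} {y} {u} {v} f g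
  with x <ᵇ y | x ≡ᵇ y | y <ᵇ x | compare x y
... | _ | _ | _ | lt x<y = sym (≢⇒≡ᵇ-false u v λ u≡v → Fin.<⇒≢ x<y (g u≡v))
... | _ | _ | _ | gt y<x = sym (≢⇒≡ᵇ-false u v λ u≡v → Fin.<⇒≢ y<x (sym (g u≡v)))
... | _ | _ | _ | eq x≡y = sym (trans (cong (_≡ᵇ v) (f x≡y)) (≡ᵇ-refl v))

-- Sums of indicator functions over Fin n

module IndicatorSum {c ℓ} (R : CommutativeSemiring c ℓ) where
  open CommutativeSemiring R
    hiding (refl; sym; trans; zero; distrib)
    renaming (_+_ to _⊕_)
  open CommutativeSemiring R public using () renaming
    (refl to ≈-refl; sym to ≈-sym; trans to ≈-trans)
  open import Algebra.Properties.Semiring.Sum semiring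
  open import Relation.Binary.Reasoning.Setoid setoid

  infixr 8 _⊙_

  _⊙_ : Bool → Carrier → Carrier
  b ⊙ x = if b then x else 0#

  ⊙-zeroʳ : ∀ b → b ⊙ 0# ≈ 0#
  ⊙-zeroʳ true  = ≈-refl
  ⊙-zeroʳ false = ≈-refl

  ⊙-distribˡ-+ : ∀ b x y → b ⊙ (x ⊕ y) ≈ b ⊙ x ⊕ b ⊙ y
  ⊙-distribˡ-+ true  x y = ≈-refl
  ⊙-distribˡ-+ false x y = ≈-sym (+-identityˡ 0#)

  -- Opaque, so that the length of a sum can be inferred by unification.
  opaque
    ∑ : (Fin n → Carrier) → Carrier
    ∑ = sum

    ∑≡sum : ∀ (f : Fin n → Carrier) → ∑ f ≡ sum f
    ∑≡sum f = refl

    ∑-cong : ∀ {f g : Fin n → Carrier} → (∀ i → f i ≈ g i) → ∑ f ≈ ∑ g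
    ∑-cong {n} = sum-cong-≋ {n}

    ∑-zero : ∀ {f : Fin n → Carrier} → (∀ i → f i ≈ 0#) → ∑ f ≈ 0#
    ∑-zero {n} f≈0 = ≈-trans (sum-cong-≋ {n} f≈0) (sum-replicate-zero n)

    ∑-+ : ∀ (f g : Fin n → Carrier) → ∑ (λ i → f i ⊕ g i) ≈ ∑ f ⊕ ∑ g
    ∑-+ = ∑-distrib-+

    ∑-swap : ∀ (f : Fin m → Fin n → Carrier) →
             ∑ (λ i → ∑ λ j → f i j) ≈ ∑ (λ j → ∑ λ i → f i j)
    ∑-swap = ∑-comm

    ∑-suc : ∀ (f : Fin (suc n) → Carrier) → ∑ f ≡ f zero ⊕ ∑ (f ∘ suc)
    ∑-suc f = refl

    ∑-delta : ∀ (i : Fin n) (f : Fin n → Carrier) →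
              ∑ (λ j → (i ≡ᵇ j) ⊙ f j) ≈ f i
    ∑-delta {suc n} zero    f =
      ≈-trans (+-congˡ (∑-zero {n} λ j → ≈-refl)) (+-identityʳ _)
    ∑-delta {suc n} (suc i) f = ≈-trans (+-identityˡ _) (∑-delta {n} i (f ∘ suc))

    ∑-distribˡ-* : ∀ x (f : Fin n → Carrier) → x * ∑ f ≈ ∑ λ i → x * f i
    ∑-distribˡ-* = *-distribˡ-sum

    ∑-distribʳ-* : ∀ x (f : Fin n → Carrier) → ∑ f * x ≈ ∑ λ i → f i * x
    ∑-distribʳ-* = *-distribʳ-sum

  ⊙-distribˡ-∑ : ∀ b (f : Fin n → Carrier) → b ⊙ ∑ f ≈ ∑ λ i → b ⊙ f i
  ⊙-distribˡ-∑ true  f = ≈-refl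
  ⊙-distribˡ-∑ false f = ≈-sym (∑-zero λ i → ≈-refl)

  sum₂ : (Fin m → Fin n → Carrier) → Carrier
  sum₂ f = ∑ λ i → ∑ (f i)

  sum₂-cong : ∀ {f g : Fin m → Fin n → Carrier} →
              (∀ i j → f i j ≈ g i j) → sum₂ f ≈ sum₂ g
  sum₂-cong f≈g = ∑-cong λ i → ∑-cong (f≈g i)

  sum₂-distrib-+ : ∀ (f g : Fin m → Fin n → Carrier) →
                   sum₂ (λ i j → f i j ⊕ g i j) ≈ sum₂ f ⊕ sum₂ g
  sum₂-distrib-+ f g =
    ≈-trans (∑-cong λ i → ∑-+ (f i) (g i)) (∑-+ _ _)

  ∑-* : ∀ (f : Fin m → Carrier) (g : Fin n → Carrier) →
        ∑ f * ∑ g ≈ sum₂ λ i j → f i * g j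
  ∑-* f g = ≈-trans (∑-distribʳ-* (∑ g) f) (∑-cong λ i → ∑-distribˡ-* (f i) g)

  -- An ordered pair is increasing, decreasing or diagonal; `∑-swap` renames the indices of the
  -- decreasing ones and merges them with the increasing ones.
  sum₂-split : ∀ (f : Fin n → Fin n → Carrier) →
    sum₂ f ≈ sum₂ (λ i j → (i <ᵇ j) ⊙ (f i j ⊕ f j i)) ⊕ ∑ (λ i → f i i)
  sum₂-split {n} f = begin
    sum₂ f
      ≈⟨ sum₂-cong pointwise ⟩
    sum₂ (λ i j → ((i <ᵇ j) ⊙ f i j ⊕ (j <ᵇ i) ⊙ f i j) ⊕ (i ≡ᵇ j) ⊙ f i j)
      ≈⟨ ≈-trans (sum₂-distrib-+ _ _) (+-congʳ (sum₂-distrib-+ _ _)) ⟩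
    (sum₂ (λ i j → (i <ᵇ j) ⊙ f i j) ⊕ sum₂ (λ i j → (j <ᵇ i) ⊙ f i j))
      ⊕ sum₂ (λ i j → (i ≡ᵇ j) ⊙ f i j)
      ≈⟨ +-cong (+-congˡ (∑-swap _)) (∑-cong λ i → ∑-delta i (f i)) ⟩
    (sum₂ (λ i j → (i <ᵇ j) ⊙ f i j) ⊕ sum₂ (λ i j → (i <ᵇ j) ⊙ f j i))
      ⊕ ∑ (λ i → f i i)
      ≈⟨ +-congʳ (≈-sym (≈-trans (sum₂-cong λ i j → ⊙-distribˡ-+ (i <ᵇ j) _ _)
                                (sum₂-distrib-+ _ _))) ⟩
    sum₂ (λ i j → (i <ᵇ j) ⊙ (f i j ⊕ f j i)) ⊕ ∑ (λ i → f i i) ∎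
    where
    pointwise : ∀ i j →
      f i j ≈ ((i <ᵇ j) ⊙ f i j ⊕ (j <ᵇ i) ⊙ f i j) ⊕ (i ≡ᵇ j) ⊙ f i j
    pointwise i j
      with i <ᵇ j | i ≡ᵇ j | j <ᵇ i | compare i j
    ... | _ | _ | _ | lt _ = ≈-sym (≈-trans (+-identityʳ _) (+-identityʳ _))
    ... | _ | _ | _ | eq _ = ≈-sym (≈-trans (+-congʳ (+-identityʳ _)) (+-identityˡ _))
    ... | _ | _ | _ | gt _ = ≈-sym (≈-trans (+-identityʳ _) (+-identityˡ _))

  sum₂-split-irrefl : ∀ (f : Fin n → Fin n → Carrier) → (∀ i → f i i ≈ 0#) →
    sum₂ f ≈ sum₂ (λ i j → (i <ᵇ j) ⊙ (f i j ⊕ f j i))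
  sum₂-split-irrefl f f≈0 = ≈-trans (sum₂-split f)
    (≈-trans (+-congˡ (∑-zero f≈0)) (+-identityʳ _))

  sum₃ : (Fin m → Fin n → Fin k → Carrier) → Carrier
  sum₃ f = ∑ λ i → sum₂ (f i)

  sum₃-cong : ∀ {f g : Fin m → Fin n → Fin k → Carrier} →
              (∀ i j l → f i j l ≈ g i j l) → sum₃ f ≈ sum₃ g
  sum₃-cong f≈g = ∑-cong λ i → sum₂-cong (f≈g i)

  sum₃-distrib-+ : ∀ (f g : Fin m → Fin n → Fin k → Carrier) →
                   sum₃ (λ i j l → f i j l ⊕ g i j l) ≈ sum₃ f ⊕ sum₃ g
  sum₃-distrib-+ f g =
    ≈-trans (∑-cong λ i → sum₂-distrib-+ (f i) (g i)) (∑-+ _ _)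

  -- A distinguished element i together with a pair j < l avoiding it is a
  -- three-element set with a distinguished element.
  sum₃-split : ∀ (f : Fin n → Fin n → Fin n → Carrier) →
    (∀ i l → f i i l ≈ 0#) → (∀ i j → f i j i ≈ 0#) →
    sum₃ (λ i j l → (j <ᵇ l) ⊙ f i j l) ≈
    sum₃ (λ i j l → (i <ᵇ j) ⊙ (j <ᵇ l) ⊙ ((f i j l ⊕ f j i l) ⊕ f l i j))
  sum₃-split f fiil≈0 fiji≈0 = begin
    sum₃ (λ i j l → (j <ᵇ l) ⊙ f i j l)
      ≈⟨ sum₃-cong pointwise ⟩
    sum₃ (λ i j l → ((i <ᵇ j) ⊙ (j <ᵇ l) ⊙ f i j l ⊕ (j <ᵇ i) ⊙ (i <ᵇ l) ⊙ f i j l)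
                    ⊕ (j <ᵇ l) ⊙ (l <ᵇ i) ⊙ f i j l)
      ≈⟨ ≈-trans (sum₃-distrib-+ _ _) (+-congʳ (sum₃-distrib-+ _ _)) ⟩
    (sum₃ (λ i j l → (i <ᵇ j) ⊙ (j <ᵇ l) ⊙ f i j l)
      ⊕ sum₃ (λ i j l → (j <ᵇ i) ⊙ (i <ᵇ l) ⊙ f i j l))
      ⊕ sum₃ (λ i j l → (j <ᵇ l) ⊙ (l <ᵇ i) ⊙ f i j l)
      ≈⟨ +-cong (+-congˡ (∑-swap _))
                (≈-trans (∑-swap _) (∑-cong λ j → ∑-swap _)) ⟩
    (sum₃ (λ i j l → (i <ᵇ j) ⊙ (j <ᵇ l) ⊙ f i j l)
      ⊕ sum₃ (λ i j l → (i <ᵇ j) ⊙ (j <ᵇ l) ⊙ f j i l))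
      ⊕ sum₃ (λ i j l → (i <ᵇ j) ⊙ (j <ᵇ l) ⊙ f l i j)
      ≈⟨ ≈-sym (≈-trans (sum₃-cong λ i j l → distrib (i <ᵇ j) (j <ᵇ l))
                (≈-trans (sum₃-distrib-+ _ _) (+-congʳ (sum₃-distrib-+ _ _)))) ⟩
    sum₃ (λ i j l → (i <ᵇ j) ⊙ (j <ᵇ l) ⊙ ((f i j l ⊕ f j i l) ⊕ f l i j)) ∎
    where
    distrib : ∀ b b′ {x y z} → b ⊙ b′ ⊙ ((x ⊕ y) ⊕ z) ≈
              (b ⊙ b′ ⊙ x ⊕ b ⊙ b′ ⊙ y) ⊕ b ⊙ b′ ⊙ z
    distrib true  true  = ≈-refl
    distrib true  false = ≈-sym (≈-trans (+-identityʳ _) (+-identityʳ _))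
    distrib false _     = ≈-sym (≈-trans (+-identityʳ _) (+-identityʳ _))

    first : ∀ {x} → x ≈ (x ⊕ 0#) ⊕ 0#
    first = ≈-sym (≈-trans (+-identityʳ _) (+-identityʳ _))

    second : ∀ {x} → x ≈ (0# ⊕ x) ⊕ 0#
    second = ≈-sym (≈-trans (+-identityʳ _) (+-identityˡ _))

    third : ∀ {x} → x ≈ (0# ⊕ 0#) ⊕ x
    third = ≈-sym (≈-trans (+-congʳ (+-identityˡ _)) (+-identityˡ _))

    pointwise : ∀ i j l → (j <ᵇ l) ⊙ f i j l ≈
      ((i <ᵇ j) ⊙ (j <ᵇ l) ⊙ f i j l ⊕ (j <ᵇ i) ⊙ (i <ᵇ l) ⊙ f i j l)
      ⊕ (j <ᵇ l) ⊙ (l <ᵇ i) ⊙ f i j l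
    pointwise i j l
      with i <ᵇ j | i ≡ᵇ j | j <ᵇ i | compare i j
         | i <ᵇ l | i ≡ᵇ l | l <ᵇ i | compare i l
         | j <ᵇ l | j ≡ᵇ l | l <ᵇ j | compare j l
    ... | _ | _ | _ | lt a | _ | _ | _ | lt b | _ | _ | _ | lt c = first
    ... | _ | _ | _ | lt a | _ | _ | _ | lt b | _ | _ | _ | eq c = first
    ... | _ | _ | _ | lt a | _ | _ | _ | lt b | _ | _ | _ | gt c = first
    ... | _ | _ | _ | lt a | _ | _ | _ | eq b | _ | _ | _ | lt c = first
    ... | _ | _ | _ | lt a | _ | _ | _ | eq b | _ | _ | _ | eq c = first
    ... | _ | _ | _ | lt a | _ | _ | _ | eq b | _ | _ | _ | gt c = first
    ... | _ | _ | _ | lt a | _ | _ | _ | gt b | _ | _ | _ | lt c =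
      ⊥-elim (Fin.<-asym (Fin.<-trans a c) b)
    ... | _ | _ | _ | lt a | _ | _ | _ | gt b | _ | _ | _ | eq c = first
    ... | _ | _ | _ | lt a | _ | _ | _ | gt b | _ | _ | _ | gt c = first
    -- For `j < l` with `i` equal to `j` or `l`, all three terms on the right vanish; here the
    -- hypotheses on `f` enter.
    ... | _ | _ | _ | eq refl | _ | _ | _ | lt b | _ | _ | _ | lt c =
      ≈-trans (fiil≈0 i l) first
    ... | _ | _ | _ | eq refl | _ | _ | _ | gt b | _ | _ | _ | lt c =
      ⊥-elim (Fin.<-asym b c)
    ... | _ | _ | _ | eq a | _ | _ | _ | eq b | _ | _ | _ | lt c =
      ⊥-elim (Fin.<⇒≢ c (trans (sym a) b))
    ... | _ | _ | _ | eq a | _ | _ | _ | _    | _ | _ | _ | eq c = first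
    ... | _ | _ | _ | eq a | _ | _ | _ | _    | _ | _ | _ | gt c = first
    ... | _ | _ | _ | gt a | _ | _ | _ | lt b | _ | _ | _ | lt c = second
    ... | _ | _ | _ | gt a | _ | _ | _ | lt b | _ | _ | _ | eq c =
      ⊥-elim (Fin.<⇒≢ (Fin.<-trans a b) c)
    ... | _ | _ | _ | gt a | _ | _ | _ | lt b | _ | _ | _ | gt c =
      ⊥-elim (Fin.<-asym (Fin.<-trans a b) c)
    ... | _ | _ | _ | gt a | _ | _ | _ | eq refl | _ | _ | _ | lt c =
      ≈-trans (fiji≈0 i j) first
    ... | _ | _ | _ | gt a | _ | _ | _ | eq b | _ | _ | _ | eq c = first
    ... | _ | _ | _ | gt a | _ | _ | _ | eq b | _ | _ | _ | gt c = first
    ... | _ | _ | _ | gt a | _ | _ | _ | gt b | _ | _ | _ | lt c = third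
    ... | _ | _ | _ | gt a | _ | _ | _ | gt b | _ | _ | _ | eq c = first
    ... | _ | _ | _ | gt a | _ | _ | _ | gt b | _ | _ | _ | gt c = first

-- From here on unqualified sums are taken modulo 2; counting in ℕ uses the prefix `∑ℕ`.
open module ∑ℙ = IndicatorSum ℙ.+-*-commutativeSemiring

-- Pairs of orthogonal columns

-- The map r ↦ (u r , v r) is a bijection from rows to pairs of symbols; `row` is its inverse.
record Orthogonal (u v : Fin N → Fin n) : Set where
  field
    row    : Fin n → Fin n → Fin N
    u-row  : ∀ x y → u (row x y) ≡ x
    v-row  : ∀ x y → v (row x y) ≡ y
    unique : ∀ r → row (u r) (v r) ≡ r

  row-injective : ∀ {r s} → u r ≡ u s → v r ≡ v s → r ≡ s
  row-injective {r} {s} ur≡us vr≡vs =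
    trans (sym (unique r)) (trans (cong₂ row ur≡us vr≡vs) (unique s))

  -- Change of variables along the bijection: insert the indicators of `u r = x` and `v r = y`,
  -- exchange the sums, and only the row `row x y` survives.
  ∑-rows : ∀ f → ∑ f ≡ sum₂ λ x y → f (row x y)
  ∑-rows f = begin
    ∑ f
      ≡⟨ (∑-cong λ r → trans (sym (∑-delta (v r) λ _ → f r))
                             (sym (∑-delta (u r) λ _ → ∑ λ y → (v r ≡ᵇ y) ⊙ f r))) ⟩
    ∑ (λ r → ∑ λ x → (u r ≡ᵇ x) ⊙ (∑ λ y → (v r ≡ᵇ y) ⊙ f r))
      ≡⟨ ∑-cong (λ r → ∑-cong λ x → ⊙-distribˡ-∑ (u r ≡ᵇ x) _) ⟩
    ∑ (λ r → sum₂ λ x y → (u r ≡ᵇ x) ⊙ (v r ≡ᵇ y) ⊙ f r)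
      ≡⟨ trans (∑-swap _) (∑-cong λ x → ∑-swap _) ⟩
    sum₂ (λ x y → ∑ λ r → (u r ≡ᵇ x) ⊙ (v r ≡ᵇ y) ⊙ f r)
      ≡⟨ sum₂-cong (λ x y → trans (∑-cong λ r → indicator x y r) (∑-delta (row x y) f)) ⟩
    sum₂ (λ x y → f (row x y)) ∎
    where
    open ≡-Reasoning
    indicator : ∀ x y r → (u r ≡ᵇ x) ⊙ (v r ≡ᵇ y) ⊙ f r ≡ (row x y ≡ᵇ r) ⊙ f r
    indicator x y r
      with u r <ᵇ x | u r ≡ᵇ x | x <ᵇ u r | compare (u r) x
         | v r <ᵇ y | v r ≡ᵇ y | y <ᵇ v r | compare (v r) y
    ... | _ | _ | _ | eq refl | _ | _ | _ | eq refl =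
      sym (cong (_⊙ f r) (trans (cong (_≡ᵇ r) (unique r)) (≡ᵇ-refl r)))
    ... | _ | _ | _ | lt a | _ | _ | _ | _ =
      sym (cong (_⊙ f r) (≢⇒≡ᵇ-false (row x y) r λ { refl → Fin.<⇒≢ a (u-row x y) }))
    ... | _ | _ | _ | gt a | _ | _ | _ | _ =
      sym (cong (_⊙ f r) (≢⇒≡ᵇ-false (row x y) r λ { refl → Fin.<⇒≢ a (sym (u-row x y)) }))
    ... | _ | _ | _ | eq _ | _ | _ | _ | lt a =
      sym (cong (_⊙ f r) (≢⇒≡ᵇ-false (row x y) r λ { refl → Fin.<⇒≢ a (v-row x y) }))
    ... | _ | _ | _ | eq _ | _ | _ | _ | gt a =
      sym (cong (_⊙ f r) (≢⇒≡ᵇ-false (row x y) r λ { refl → Fin.<⇒≢ a (sym (v-row x y)) }))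

orthogonal-sym : ∀ {u v : Fin N → Fin n} → Orthogonal u v → Orthogonal v u
orthogonal-sym o = record
  { row = flip row; u-row = flip v-row; v-row = flip u-row; unique = unique }
  where open Orthogonal o

-- All three count pairs of rows modulo 2. A pair inverted by v is ordered by
-- Fin N, whereas discordances u v w does not depend on the order of the rows.

columnInversions : (Fin N → Fin n) → Parity
columnInversions v = sum₂ λ r s → (r <ᵇ s) ⊙ (v s <ᵇ v r) ⊙ 1ℙ

relativeInversions : (u v : Fin N → Fin n) → Parity
relativeInversions u v =
  sum₂ λ r s → (r <ᵇ s) ⊙ (u r ≡ᵇ u s) ⊙ (v s <ᵇ v r) ⊙ 1ℙ

discordances : (u v w : Fin N → Fin n) → Parity
discordances u v w =
  sum₂ λ r s → (u r ≡ᵇ u s) ⊙ (v r <ᵇ v s) ⊙ (w s <ᵇ w r) ⊙ 1ℙ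

pairs : ℕ → Parity
pairs n = sum₂ {n} {n} λ x y → (x <ᵇ y) ⊙ 1ℙ

-- When `u` and `w` are orthogonal, y ↦ `w (row x y)` is a permutation for each `x`, and the right
-- side adds up the parities of these permutations: it is a parity of the Latin square on the three
-- columns.
discordances-rows : ∀ {u v : Fin N → Fin n} (w : Fin N → Fin n)
  (o : Orthogonal u v) → let open Orthogonal o in
  discordances u v w ≡
  ∑ λ x → sum₂ λ y y′ → (y <ᵇ y′) ⊙ (w (row x y′) <ᵇ w (row x y)) ⊙ 1ℙ
discordances-rows {u = u} {v} w o = begin
  discordances u v w
    ≡⟨ trans (∑-rows _) (sum₂-cong λ x y → ∑-rows _) ⟩
  (sum₂ λ x y → sum₂ λ x′ y′ →
    (u (row x y) ≡ᵇ u (row x′ y′)) ⊙ (v (row x y) <ᵇ v (row x′ y′)) ⊙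
    (w (row x′ y′) <ᵇ w (row x y)) ⊙ 1ℙ)
    ≡⟨ (sum₂-cong λ x y → sum₂-cong λ x′ y′ →
         cong₂ (λ b b′ → b ⊙ b′ ⊙ (w (row x′ y′) <ᵇ w (row x y)) ⊙ 1ℙ)
               (cong₂ _≡ᵇ_ (u-row x y) (u-row x′ y′))
               (cong₂ _<ᵇ_ (v-row x y) (v-row x′ y′))) ⟩
  (sum₂ λ x y → sum₂ λ x′ y′ →
    (x ≡ᵇ x′) ⊙ (y <ᵇ y′) ⊙ (w (row x′ y′) <ᵇ w (row x y)) ⊙ 1ℙ)
    ≡⟨ (sum₂-cong λ x y → trans (∑-cong λ x′ → sym (⊙-distribˡ-∑ (x ≡ᵇ x′) _))
                                (∑-delta x _)) ⟩
  (∑ λ x → sum₂ λ y y′ → (y <ᵇ y′) ⊙ (w (row x y′) <ᵇ w (row x y)) ⊙ 1ℙ) ∎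
  where
  open ≡-Reasoning
  open Orthogonal o

-- Distinct rows that agree in `u` differ in `v` and in `w`. On such a pair r < s, `v` and `w`
-- disagree about the order exactly when one but not both of them invert it.
discordances≡relativeInversions : ∀ {u v w : Fin N → Fin n} →
  Orthogonal u v → Orthogonal u w →
  discordances u v w ≡ relativeInversions u v ℙ.+ relativeInversions u w
discordances≡relativeInversions {u = u} {v} {w} o₁ o₂ =
  trans (sum₂-split-irrefl _ irrefl)
        (trans (sum₂-cong pointwise) (sum₂-distrib-+ _ _))
  where
  irrefl : ∀ r → (u r ≡ᵇ u r) ⊙ (v r <ᵇ v r) ⊙ (w r <ᵇ w r) ⊙ 1ℙ ≡ 0ℙ
  irrefl r rewrite <ᵇ-irrefl (v r) = ⊙-zeroʳ (u r ≡ᵇ u r)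

  pointwise : ∀ r s →
    (r <ᵇ s) ⊙ ((u r ≡ᵇ u s) ⊙ (v r <ᵇ v s) ⊙ (w s <ᵇ w r) ⊙ 1ℙ ℙ.+
                (u s ≡ᵇ u r) ⊙ (v s <ᵇ v r) ⊙ (w r <ᵇ w s) ⊙ 1ℙ) ≡
    (r <ᵇ s) ⊙ (u r ≡ᵇ u s) ⊙ (v s <ᵇ v r) ⊙ 1ℙ ℙ.+
    (r <ᵇ s) ⊙ (u r ≡ᵇ u s) ⊙ (w s <ᵇ w r) ⊙ 1ℙ
  pointwise r s
    rewrite ≡ᵇ-cong-⇔ {x = u s} {u r} sym sym
    with r <ᵇ s | r ≡ᵇ s | s <ᵇ r | compare r s
       | u r <ᵇ u s | u r ≡ᵇ u s | u s <ᵇ u r | compare (u r) (u s)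
       | v r <ᵇ v s | v r ≡ᵇ v s | v s <ᵇ v r | compare (v r) (v s)
       | w r <ᵇ w s | w r ≡ᵇ w s | w s <ᵇ w r | compare (w r) (w s)
  ... | _ | _ | _ | eq _ | _ | _ | _ | _ | _ | _ | _ | _ | _ | _ | _ | _ = refl
  ... | _ | _ | _ | gt _ | _ | _ | _ | _ | _ | _ | _ | _ | _ | _ | _ | _ = refl
  ... | _ | _ | _ | lt a | _ | _ | _ | lt _ | _ | _ | _ | _ | _ | _ | _ | _ = refl
  ... | _ | _ | _ | lt a | _ | _ | _ | gt _ | _ | _ | _ | _ | _ | _ | _ | _ = refl
  ... | _ | _ | _ | lt a | _ | _ | _ | eq b | _ | _ | _ | eq c | _ | _ | _ | _ =
    ⊥-elim (Fin.<⇒≢ a (Orthogonal.row-injective o₁ b c))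
  ... | _ | _ | _ | lt a | _ | _ | _ | eq b | _ | _ | _ | _ | _ | _ | _ | eq c =
    ⊥-elim (Fin.<⇒≢ a (Orthogonal.row-injective o₂ b c))
  ... | _ | _ | _ | lt a | _ | _ | _ | eq b | _ | _ | _ | lt c | _ | _ | _ | lt d = refl
  ... | _ | _ | _ | lt a | _ | _ | _ | eq b | _ | _ | _ | lt c | _ | _ | _ | gt d = refl
  ... | _ | _ | _ | lt a | _ | _ | _ | eq b | _ | _ | _ | gt c | _ | _ | _ | lt d = refl
  ... | _ | _ | _ | lt a | _ | _ | _ | eq b | _ | _ | _ | gt c | _ | _ | _ | gt d = refl

relativeInversions-irrefl : ∀ (v : Fin N → Fin n) → relativeInversions v v ≡ 0ℙ
relativeInversions-irrefl v = ∑-zero λ r → ∑-zero λ s → pointwise r s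
  where
  pointwise : ∀ r s → (r <ᵇ s) ⊙ (v r ≡ᵇ v s) ⊙ (v s <ᵇ v r) ⊙ 1ℙ ≡ 0ℙ
  pointwise r s
    with v r <ᵇ v s | v r ≡ᵇ v s | v s <ᵇ v r | compare (v r) (v s)
  ... | _ | _ | _ | lt _ = ⊙-zeroʳ (r <ᵇ s)
  ... | _ | _ | _ | eq _ = ⊙-zeroʳ (r <ᵇ s)
  ... | _ | _ | _ | gt _ = ⊙-zeroʳ (r <ᵇ s)

-- columnInversions u + relativeInversions u v is the parity of the permutation
-- sorting the rows lexicographically by (u , v). Exchanging u and v amounts to
-- transposing an n × n array, a product of n(n−1)/2 transpositions.
lexicographic-swap : ∀ {u v : Fin N → Fin n} → Orthogonal u v →
  (columnInversions u ℙ.+ relativeInversions u v) ℙ.+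
  (columnInversions v ℙ.+ relativeInversions v u) ≡ pairs n
lexicographic-swap {N} {n} {u} {v} o = begin
  (columnInversions u ℙ.+ relativeInversions u v) ℙ.+
  (columnInversions v ℙ.+ relativeInversions v u)
    ≡⟨ sym (trans (sum₂-distrib-+ _ _)
                  (cong₂ ℙ._+_ (sum₂-distrib-+ _ _) (sum₂-distrib-+ _ _))) ⟩
  sum₂ _
    -- For r < s the four indicators add up to 1 modulo 2 exactly when `u` and `v` order the two
    -- rows strictly oppositely; if just one of the columns agrees on them, equal terms cancel.
    ≡⟨ sum₂-cong pointwise ⟩
  sum₂ (λ r s → (r <ᵇ s) ⊙ ((u r <ᵇ u s) ⊙ (v s <ᵇ v r) ⊙ 1ℙ ℙ.+
                            (u s <ᵇ u r) ⊙ (v r <ᵇ v s) ⊙ 1ℙ))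
    ≡⟨ sym (sum₂-split-irrefl _ irrefl) ⟩
  sum₂ (λ r s → (u r <ᵇ u s) ⊙ (v s <ᵇ v r) ⊙ 1ℙ)
    ≡⟨ trans (∑-rows _) (sum₂-cong λ x y → ∑-rows _) ⟩
  sum₂ (λ x y → sum₂ λ x′ y′ → (u (row x y) <ᵇ u (row x′ y′)) ⊙
                               (v (row x′ y′) <ᵇ v (row x y)) ⊙ 1ℙ)
    ≡⟨ (sum₂-cong λ x y → sum₂-cong λ x′ y′ →
         cong₂ (λ b b′ → b ⊙ b′ ⊙ 1ℙ)
               (cong₂ _<ᵇ_ (u-row x y) (u-row x′ y′))
               (cong₂ _<ᵇ_ (v-row x′ y′) (v-row x y))) ⟩
  sum₂ (λ x y → sum₂ λ x′ y′ → (x <ᵇ x′) ⊙ (y′ <ᵇ y) ⊙ 1ℙ)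
    ≡⟨ ∑-cong (λ x → trans (∑-swap _) (∑-cong λ x′ →
         trans (∑-cong λ y → sym (⊙-distribˡ-∑ (x <ᵇ x′) _))
               (trans (sym (⊙-distribˡ-∑ (x <ᵇ x′) _))
                      (cong ((x <ᵇ x′) ⊙_) (∑-swap _))))) ⟩
  sum₂ {n} {n} (λ x x′ → (x <ᵇ x′) ⊙ pairs n)
    -- The sum is the product of `pairs n` with itself, and squaring is the identity modulo 2.
    ≡⟨ idempotent (pairs n) refl ⟩
  pairs n ∎
  where
  open ≡-Reasoning
  open Orthogonal o

  idempotent : ∀ p → p ≡ pairs n → sum₂ {n} {n} (λ x x′ → (x <ᵇ x′) ⊙ p) ≡ p
  idempotent 0ℙ _ = ∑-zero λ x → ∑-zero λ x′ → ⊙-zeroʳ (x <ᵇ x′)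
  idempotent 1ℙ p = sym p

  irrefl : ∀ r → (u r <ᵇ u r) ⊙ (v r <ᵇ v r) ⊙ 1ℙ ≡ 0ℙ
  irrefl r rewrite <ᵇ-irrefl (u r) = refl

  pointwise : ∀ r s →
    ((r <ᵇ s) ⊙ (u s <ᵇ u r) ⊙ 1ℙ ℙ.+
     (r <ᵇ s) ⊙ (u r ≡ᵇ u s) ⊙ (v s <ᵇ v r) ⊙ 1ℙ) ℙ.+
    ((r <ᵇ s) ⊙ (v s <ᵇ v r) ⊙ 1ℙ ℙ.+
     (r <ᵇ s) ⊙ (v r ≡ᵇ v s) ⊙ (u s <ᵇ u r) ⊙ 1ℙ) ≡
    (r <ᵇ s) ⊙ ((u r <ᵇ u s) ⊙ (v s <ᵇ v r) ⊙ 1ℙ ℙ.+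
                (u s <ᵇ u r) ⊙ (v r <ᵇ v s) ⊙ 1ℙ)
  pointwise r s
    with r <ᵇ s
       | u r <ᵇ u s | u r ≡ᵇ u s | u s <ᵇ u r | compare (u r) (u s)
       | v r <ᵇ v s | v r ≡ᵇ v s | v s <ᵇ v r | compare (v r) (v s)
  ... | false | _ | _ | _ | _ | _ | _ | _ | _ = refl
  ... | true | _ | _ | _ | lt _ | _ | _ | _ | lt _ = refl
  ... | true | _ | _ | _ | lt _ | _ | _ | _ | eq _ = refl
  ... | true | _ | _ | _ | lt _ | _ | _ | _ | gt _ = refl
  ... | true | _ | _ | _ | eq _ | _ | _ | _ | lt _ = refl
  ... | true | _ | _ | _ | eq _ | _ | _ | _ | eq _ = refl
  ... | true | _ | _ | _ | eq _ | _ | _ | _ | gt _ = refl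
  ... | true | _ | _ | _ | gt _ | _ | _ | _ | lt _ = refl
  ... | true | _ | _ | _ | gt _ | _ | _ | _ | eq _ = refl
  ... | true | _ | _ | _ | gt _ | _ | _ | _ | gt _ = refl

-- The tournament of a complete array

-- Pigeonhole: a missed value `y` could be removed by `punchOut`, leaving an injection of
-- `Fin (suc n)` into `Fin n`.
injective⇒surjective : ∀ {f : Fin n → Fin n} → Injective _≡_ _≡_ f →
                       ∀ y → ∃ λ x → f x ≡ y
injective⇒surjective {suc n} {f} f-inj y with Fin.any? (λ x → f x Fin.≟ y)
... | yes fx≡y = fx≡y
... | no  fx≢y = ⊥-elim (ℕ.1+n≰n (Fin.injective⇒≤ {f = λ x → punchOut (y≢f x)}
  λ {x} {x′} p → f-inj (Fin.punchOut-injective (y≢f x) (y≢f x′) p)))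
  where
  y≢f : ∀ x → y ≢ f x
  y≢f x y≡fx = fx≢y (x , sym y≡fx)

record Tournament (t : Fin k → Fin k → Parity) : Set where
  field
    irrefl  : ∀ i → t i i ≡ 0ℙ
    antisym : ∀ {i j} → i ≢ j → t j i ≡ t i j ℙ.⁻¹

module CompleteArray (c : Fin (suc n) → Fin N → Fin n)
  (orth : ∀ {i j} → i ≢ j → Orthogonal (c i) (c j)) where

  -- If r and s disagree in column 0, then each other column i has a row which
  -- agrees with r in column i and with s in column 0. These rows are distinct,
  -- so they are all n rows agreeing with s in column 0.
  agreement-exists : ∀ r s → ∃ λ i → c i r ≡ c i s
  agreement-exists r s with c zero r Fin.≟ c zero s
  ... | yes c≡ = zero , c≡
  ... | no  c≢ = go n c orth c≢
    where
    go : ∀ n (c : Fin (suc n) → Fin N → Fin n) →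
         (∀ {i j} → i ≢ j → Orthogonal (c i) (c j)) →
         c zero r ≢ c zero s → ∃ λ i → c i r ≡ c i s
    go zero    c _    _   with () ← c zero r
    go (suc n) c orth c≢ = suc i , (begin
      c (suc i) r         ≡⟨ sym (u-row i) ⟩
      c (suc i) (line i)  ≡⟨ cong (c (suc i)) (row-injective (orth {zero} {suc zero} λ ()) (v-row i) fi≡) ⟩
      c (suc i) s         ∎)
      where
      open ≡-Reasoning
      open Orthogonal using (row-injective)
      module O (i : Fin (suc n)) = Orthogonal (orth {suc i} {zero} λ ())

      line : Fin (suc n) → Fin N
      line i = O.row i (c (suc i) r) (c zero s)

      u-row : ∀ i → c (suc i) (line i) ≡ c (suc i) r
      u-row i = O.u-row i _ _

      v-row : ∀ i → c zero (line i) ≡ c zero s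
      v-row i = O.v-row i _ _

      -- All the lines share the entry of `s` in column 0, so the entry in column 1 determines the
      -- line.
      f : Fin (suc n) → Fin (suc n)
      f i = c (suc zero) (line i)

      f-injective : Injective _≡_ _≡_ f
      f-injective {i} {j} fi≡fj with i Fin.≟ j
      ... | yes i≡j = i≡j
      ... | no  i≢j = ⊥-elim (c≢ (trans (cong (c zero) r≡line) (v-row i)))
        where
        lines≡ : line i ≡ line j
        lines≡ = row-injective (orth {zero} {suc zero} λ ())
                   (trans (v-row i) (sym (v-row j))) fi≡fj

        -- A common line would agree with `r` in two columns and so be `r`, which differs from `s`
        -- in column 0.
        r≡line : r ≡ line i
        r≡line = row-injective (orth (i≢j ∘ Fin.suc-injective)) (sym (u-row i))
          (trans (sym (u-row j)) (cong (c (suc j)) (sym lines≡)))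

      preimage : ∃ λ i → f i ≡ c (suc zero) s
      preimage = injective⇒surjective f-injective (c (suc zero) s)

      i    = proj₁ preimage
      fi≡  = proj₂ preimage

  -- The agreeing column is unique, since rows that agree in two columns are equal; the sum has a
  -- single nonzero term.
  ∑-agreements : ∀ {r s} → r ≢ s → ∑ (λ i → (c i r ≡ᵇ c i s) ⊙ 1ℙ) ≡ 1ℙ
  ∑-agreements {r} {s} r≢s with i , ci≡ ← agreement-exists r s =
    trans (∑-cong λ j → cong (_⊙ 1ℙ) (≡ᵇ-cong-⇔ (only j) λ { refl → ci≡ }))
          (∑-delta i λ _ → 1ℙ)
    where
    only : ∀ j → c j r ≡ c j s → i ≡ j
    only j cj≡ with i Fin.≟ j
    ... | yes i≡j = i≡j
    ... | no  i≢j = ⊥-elim (r≢s (Orthogonal.row-injective (orth i≢j) ci≡ cj≡))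

  -- Each pair of rows inverted by `v` is counted for the one column in which the two rows agree.
  ∑-relativeInversions : ∀ (v : Fin N → Fin n) →
    ∑ (λ i → relativeInversions (c i) v) ≡ columnInversions v
  ∑-relativeInversions v =
    trans (trans (∑-swap _) (∑-cong λ r → ∑-swap _))
          (sum₂-cong λ r s → inner r s)
    where
    inner : ∀ r s → ∑ (λ i → (r <ᵇ s) ⊙ (c i r ≡ᵇ c i s) ⊙ (v s <ᵇ v r) ⊙ 1ℙ) ≡
            (r <ᵇ s) ⊙ (v s <ᵇ v r) ⊙ 1ℙ
    inner r s with r <ᵇ s | r ≡ᵇ s | s <ᵇ r | compare r s | v s <ᵇ v r
    ... | _ | _ | _ | lt r<s | true  = ∑-agreements (Fin.<⇒≢ r<s)
    ... | _ | _ | _ | lt r<s | false = ∑-zero λ i → ⊙-zeroʳ (c i r ≡ᵇ c i s)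
    ... | _ | _ | _ | eq _   | _     = ∑-zero λ i → refl
    ... | _ | _ | _ | gt _   | _     = ∑-zero λ i → refl

  private
    D : Fin (suc n) → Parity
    D i = columnInversions (c i)

    T : Fin (suc n) → Fin (suc n) → Parity
    T i j = relativeInversions (c i) (c j)

  -- For i ≢ j, the parity of the permutation sorting the rows
  -- lexicographically by the columns i and j.
  arc : Fin (suc n) → Fin (suc n) → Parity
  arc i j = (D i ℙ.+ T i j) ℙ.+ (i ≡ᵇ j) ⊙ D i

  private
    arc-≢ : ∀ {i j} → i ≢ j → arc i j ≡ D i ℙ.+ T i j
    arc-≢ {i} {j} i≢j = trans
      (cong (λ b → (D i ℙ.+ T i j) ℙ.+ b ⊙ D i) (≢⇒≡ᵇ-false i j i≢j))
      (ℙ.+-identityʳ _)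

    +≡1⇒⁻¹ : ∀ p q → p ℙ.+ q ≡ 1ℙ → q ≡ p ℙ.⁻¹
    +≡1⇒⁻¹ 0ℙ 1ℙ _ = refl
    +≡1⇒⁻¹ 1ℙ 0ℙ _ = refl

    cancel : ∀ d p q → (d ℙ.+ p) ℙ.+ (d ℙ.+ q) ≡ p ℙ.+ q
    cancel 0ℙ p  q  = refl
    cancel 1ℙ 0ℙ 0ℙ = refl
    cancel 1ℙ 0ℙ 1ℙ = refl
    cancel 1ℙ 1ℙ 0ℙ = refl
    cancel 1ℙ 1ℙ 1ℙ = refl

  -- By `lexicographic-swap`, `arc i j` and `arc j i` add up to `pairs n`.
  arc-tournament : pairs n ≡ 1ℙ → Tournament arc
  arc-tournament pairs≡1 = record { irrefl = irrefl ; antisym = antisym }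
    where
    -- On the diagonal the correction term of `arc` cancels `D i`.
    irrefl : ∀ i → arc i i ≡ 0ℙ
    irrefl i = trans
      (cong₂ (λ p b → (D i ℙ.+ p) ℙ.+ b ⊙ D i)
             (relativeInversions-irrefl (c i)) (≡ᵇ-refl i))
      (trans (cong (ℙ._+ D i) (ℙ.+-identityʳ (D i))) (ℙ.p+p≡0ℙ (D i)))

    antisym : ∀ {i j} → i ≢ j → arc j i ≡ arc i j ℙ.⁻¹
    antisym {i} {j} i≢j = +≡1⇒⁻¹ (arc i j) (arc j i) (trans
      (cong₂ ℙ._+_ (arc-≢ i≢j) (arc-≢ (i≢j ∘ sym)))
      (trans (lexicographic-swap (orth i≢j)) pairs≡1))

  -- `D i` occurs in both arcs and cancels modulo 2, so arcs may replace relative inversions.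
  discordances≡arcs : ∀ {i j l} → i ≢ j → i ≢ l →
    discordances (c i) (c j) (c l) ≡ arc i j ℙ.+ arc i l
  discordances≡arcs {i} {j} {l} i≢j i≢l = begin
    discordances (c i) (c j) (c l)
      ≡⟨ discordances≡relativeInversions (orth i≢j) (orth i≢l) ⟩
    T i j ℙ.+ T i l
      ≡⟨ sym (cancel (D i) (T i j) (T i l)) ⟩
    (D i ℙ.+ T i j) ℙ.+ (D i ℙ.+ T i l)
      ≡⟨ sym (cong₂ ℙ._+_ (arc-≢ i≢j) (arc-≢ i≢l)) ⟩
    arc i j ℙ.+ arc i l ∎
    where open ≡-Reasoning

  -- The terms `T i j` sum to `D j` by `∑-relativeInversions`, and the diagonal correction
  -- contributes `D j` again. What remains is independent of `j`: all indegrees have the same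
  -- parity.
  ∑-arcs-into : ∀ j → ∑ (λ i → arc i j) ≡ ∑ D
  ∑-arcs-into j = begin
    ∑ (λ i → arc i j)
      ≡⟨ trans (∑-+ _ _) (cong (ℙ._+ ∑ λ i → (i ≡ᵇ j) ⊙ D i) (∑-+ _ _)) ⟩
    (∑ D ℙ.+ ∑ (λ i → T i j)) ℙ.+ ∑ (λ i → (i ≡ᵇ j) ⊙ D i)
      ≡⟨ cong₂ (λ p q → (∑ D ℙ.+ p) ℙ.+ q) (∑-relativeInversions (c j))
           (trans (∑-cong λ i → cong (_⊙ D i) (≡ᵇ-cong-⇔ {x = i} {j} sym sym))
                  (∑-delta j D)) ⟩
    (∑ D ℙ.+ D j) ℙ.+ D j
      ≡⟨ trans (ℙ.+-assoc (∑ D) (D j) (D j))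
               (trans (cong (∑ D ℙ.+_) (ℙ.p+p≡0ℙ (D j))) (ℙ.+-identityʳ (∑ D))) ⟩
    ∑ D ∎
    where open ≡-Reasoning

-- Counting cyclic triangles

module ∑ℕ = IndicatorSum ℕ.+-*-commutativeSemiring

parity-∑ : ∀ (f : Fin n → ℕ) → ℕ.parity (∑ℕ.∑ f) ≡ ∑ (ℕ.parity ∘ f)
parity-∑ {zero}  f = trans (cong ℕ.parity (∑ℕ.∑≡sum f)) (sym (∑≡sum _))
parity-∑ {suc n} f = begin
  ℕ.parity (∑ℕ.∑ f)
    ≡⟨ cong ℕ.parity (∑ℕ.∑-suc f) ⟩
  ℕ.parity (f zero + ∑ℕ.∑ (f ∘ suc))
    ≡⟨ ℙ.+-homo-+ (f zero) _ ⟩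
  ℕ.parity (f zero) ℙ.+ ℕ.parity (∑ℕ.∑ (f ∘ suc))
    ≡⟨ cong (ℕ.parity (f zero) ℙ.+_) (parity-∑ (f ∘ suc)) ⟩
  ℕ.parity (f zero) ℙ.+ ∑ (ℕ.parity ∘ f ∘ suc)
    ≡⟨ sym (∑-suc _) ⟩
  ∑ (ℕ.parity ∘ f) ∎
  where open ≡-Reasoning

∑-const : ∀ n x → ∑ℕ.∑ {n} (λ _ → x) ≡ n ℕ.* x
∑-const zero    x = ∑ℕ.∑≡sum _
∑-const (suc n) x = trans (∑ℕ.∑-suc _) (cong (x ℕ.+_) (∑-const n x))

-- The binomial coefficients C(n, 2) and C(n, 3).
#pairs #triples : ℕ → ℕ
#pairs   n = ∑ℕ.sum₂ {n} {n} λ i j → (i <ᵇ j) ∑ℕ.⊙ 1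
#triples n = ∑ℕ.sum₃ {n} {n} {n} λ i j l → (i <ᵇ j) ∑ℕ.⊙ (j <ᵇ l) ∑ℕ.⊙ 1

#pairs-suc : ∀ n → #pairs (suc n) ≡ n + #pairs n
#pairs-suc n = trans (∑ℕ.∑-suc _) (cong₂ _+_
  (trans (∑ℕ.∑-suc _) (trans (∑-const n 1) (ℕ.*-identityʳ n)))
  (∑ℕ.∑-cong λ i → ∑ℕ.∑-suc _))

#triples-suc : ∀ n → #triples (suc n) ≡ #pairs n + #triples n
#triples-suc n = trans (∑ℕ.∑-suc _) (cong₂ _+_
  (trans (∑ℕ.∑-suc _) (cong₂ _+_ (∑ℕ.∑-zero λ l → refl) (∑ℕ.∑-cong λ j → ∑ℕ.∑-suc _)))
  (∑ℕ.∑-cong λ i → trans (∑ℕ.∑-suc _) (cong₂ _+_ (∑ℕ.∑-zero λ l → refl)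
    (∑ℕ.∑-cong λ j → trans (∑ℕ.∑-suc _)
      (cong₂ _+_ (∑ℕ.⊙-zeroʳ (i <ᵇ j)) refl)))))

-- The closed forms of C(n, 2) here and of C(n, 3) below are cleared of division and subtraction, so
-- that the induction needs only ring identities in ℕ.
2*#pairs : ∀ n → 2 ℕ.* #pairs n + n ≡ n ℕ.* n
2*#pairs zero = cong (λ p → 2 ℕ.* p + 0) (∑ℕ.∑≡sum {zero} _)
2*#pairs (suc n) = begin
  2 ℕ.* #pairs (suc n) + suc n    ≡⟨ cong (λ p → 2 ℕ.* p + suc n) (#pairs-suc n) ⟩
  2 ℕ.* (n + #pairs n) + suc n    ≡⟨ regroup n (#pairs n) ⟩
  (2 ℕ.* #pairs n + n) + (2 ℕ.* n + 1) ≡⟨ cong (_+ (2 ℕ.* n + 1)) (2*#pairs n) ⟩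
  n ℕ.* n + (2 ℕ.* n + 1)         ≡⟨ square n ⟩
  suc n ℕ.* suc n                 ∎
  where
  open ≡-Reasoning
  regroup : ∀ n p → 2 ℕ.* (n + p) + suc n ≡ (2 ℕ.* p + n) + (2 ℕ.* n + 1)
  regroup = solve-∀
  square : ∀ n → n ℕ.* n + (2 ℕ.* n + 1) ≡ suc n ℕ.* suc n
  square = solve-∀

6*#triples : ∀ n → 6 ℕ.* #triples n + 3 ℕ.* (n ℕ.* n) ≡ n ℕ.* (n ℕ.* n) + 2 ℕ.* n
6*#triples zero = cong (λ p → 6 ℕ.* p + 0) (∑ℕ.∑≡sum {zero} _)
6*#triples (suc n) = begin
  6 ℕ.* #triples (suc n) + 3 ℕ.* (suc n ℕ.* suc n)
    ≡⟨ cong (λ p → 6 ℕ.* p + 3 ℕ.* (suc n ℕ.* suc n)) (#triples-suc n) ⟩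
  6 ℕ.* (#pairs n + #triples n) + 3 ℕ.* (suc n ℕ.* suc n)
    ≡⟨ regroup n (#pairs n) (#triples n) ⟩
  (6 ℕ.* #triples n + 3 ℕ.* (n ℕ.* n)) + (3 ℕ.* (2 ℕ.* #pairs n + n) + 3 ℕ.* n + 3)
    ≡⟨ cong₂ (λ p q → p + (3 ℕ.* q + 3 ℕ.* n + 3)) (6*#triples n) (2*#pairs n) ⟩
  (n ℕ.* (n ℕ.* n) + 2 ℕ.* n) + (3 ℕ.* (n ℕ.* n) + 3 ℕ.* n + 3)
    ≡⟨ cube n ⟩
  suc n ℕ.* (suc n ℕ.* suc n) + 2 ℕ.* suc n ∎
  where
  open ≡-Reasoning
  regroup : ∀ n p t → 6 ℕ.* (p + t) + 3 ℕ.* (suc n ℕ.* suc n) ≡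
    (6 ℕ.* t + 3 ℕ.* (n ℕ.* n)) + (3 ℕ.* (2 ℕ.* p + n) + 3 ℕ.* n + 3)
  regroup = solve-∀
  cube : ∀ n → (n ℕ.* (n ℕ.* n) + 2 ℕ.* n) + (3 ℕ.* (n ℕ.* n) + 3 ℕ.* n + 3) ≡
    suc n ℕ.* (suc n ℕ.* suc n) + 2 ℕ.* suc n
  cube = solve-∀

bit : Parity → ℕ
bit 0ℙ = 0
bit 1ℙ = 1

parity-bit : ∀ p → ℕ.parity (bit p) ≡ p
parity-bit 0ℙ = refl
parity-bit 1ℙ = refl

parity-#pairs : ∀ n → ℕ.parity (#pairs n) ≡ pairs n
parity-#pairs n = trans (parity-∑ _) (∑-cong λ i → trans (parity-∑ _)
  (∑-cong λ j → parity-⊙ (i <ᵇ j)))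
  where
  parity-⊙ : ∀ b → ℕ.parity (b ∑ℕ.⊙ 1) ≡ b ⊙ 1ℙ
  parity-⊙ true  = refl
  parity-⊙ false = refl

-- Built like `equiparity?`, so that the two decisions coincide by `refl` once the three parities
-- are rewritten.
all-equal : Parity → Parity → Parity → Bool
all-equal p q r = does (p ℙ.≟ q ×-dec q ℙ.≟ r)

-- In a tournament t i j + t i l = 1 says that i has indegree one in the triangle
-- i j l. The three sums add up to 1, so they agree only if all of them are 1.
cyclicTriangles : (Fin k → Fin k → Parity) → ℕ
cyclicTriangles t = ∑ℕ.sum₃ λ i j l → (i <ᵇ j) ∑ℕ.⊙ (j <ᵇ l) ∑ℕ.⊙
  all-equal (t i j ℙ.+ t i l) (t j i ℙ.+ t j l) (t l i ℙ.+ t l j) ∑ℕ.⊙ 1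

indegree : (Fin k → Fin k → Parity) → Fin k → ℕ
indegree t j = ∑ℕ.∑ λ i → bit (t i j)

module TournamentCount {t : Fin k → Fin k → Parity} (T : Tournament t) where
  open Tournament T

  -- Each unordered pair of vertices carries exactly one arc.
  ∑-indegree : ∑ℕ.∑ (indegree t) ≡ #pairs k
  ∑-indegree = trans (∑ℕ.sum₂-split-irrefl _ λ i → cong bit (irrefl i))
                     (∑ℕ.sum₂-cong pointwise)
    where
    bit-⁻¹ : ∀ p → bit (p ℙ.⁻¹) + bit p ≡ 1
    bit-⁻¹ 0ℙ = refl
    bit-⁻¹ 1ℙ = refl

    pointwise : ∀ i j → (i <ᵇ j) ∑ℕ.⊙ (bit (t j i) + bit (t i j)) ≡ (i <ᵇ j) ∑ℕ.⊙ 1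
    pointwise i j with i <ᵇ j | i ≡ᵇ j | j <ᵇ i | compare i j
    ... | _ | _ | _ | lt i<j rewrite antisym (Fin.<⇒≢ i<j) = bit-⁻¹ (t i j)
    ... | _ | _ | _ | eq _   = refl
    ... | _ | _ | _ | gt _   = refl

  private
    -- Pairs of arcs with a common head.
    wedges : ℕ
    wedges = ∑ℕ.sum₃ λ i j l → (j <ᵇ l) ∑ℕ.⊙ (bit (t j i) ℕ.* bit (t l i))

  -- A triangle is either cyclic or has exactly one vertex of indegree two.
  cyclicTriangles+wedges : cyclicTriangles t + wedges ≡ #triples k
  cyclicTriangles+wedges = begin
    cyclicTriangles t + wedges
      ≡⟨ cong (cyclicTriangles t ℕ.+_) (∑ℕ.sum₃-split wedge wedge₁ wedge₂) ⟩
    cyclicTriangles t + (∑ℕ.sum₃ λ i j l → (i <ᵇ j) ∑ℕ.⊙ (j <ᵇ l) ∑ℕ.⊙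
      ((wedge i j l + wedge j i l) + wedge l i j))
      ≡⟨ sym (∑ℕ.sum₃-distrib-+ _ _) ⟩
    ∑ℕ.sum₃ _
      ≡⟨ ∑ℕ.sum₃-cong pointwise ⟩
    #triples k ∎
    where
    open ≡-Reasoning
    wedge : (i j l : Fin k) → ℕ
    wedge i j l = bit (t j i) ℕ.* bit (t l i)

    wedge₁ : ∀ i l → wedge i i l ≡ 0
    wedge₁ i l rewrite irrefl i = refl

    wedge₂ : ∀ i j → wedge i j i ≡ 0
    wedge₂ i j rewrite irrefl i = ℕ.*-zeroʳ (bit (t j i))

    -- `p`, `q`, `r` stand for `t i j`, `t i l`, `t j l`; antisymmetry gives the other three arcs,
    -- which leaves eight orientations.
    triangle : ∀ p q r →
      all-equal (p ℙ.+ q) (p ℙ.⁻¹ ℙ.+ r) (q ℙ.⁻¹ ℙ.+ r ℙ.⁻¹) ∑ℕ.⊙ 1 +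
      ((bit (p ℙ.⁻¹) ℕ.* bit (q ℙ.⁻¹) + bit p ℕ.* bit (r ℙ.⁻¹)) + bit q ℕ.* bit r) ≡ 1
    triangle 0ℙ 0ℙ 0ℙ = refl
    triangle 0ℙ 0ℙ 1ℙ = refl
    triangle 0ℙ 1ℙ 0ℙ = refl
    triangle 0ℙ 1ℙ 1ℙ = refl
    triangle 1ℙ 0ℙ 0ℙ = refl
    triangle 1ℙ 0ℙ 1ℙ = refl
    triangle 1ℙ 1ℙ 0ℙ = refl
    triangle 1ℙ 1ℙ 1ℙ = refl

    pointwise : ∀ i j l →
      (i <ᵇ j) ∑ℕ.⊙ (j <ᵇ l) ∑ℕ.⊙
        all-equal (t i j ℙ.+ t i l) (t j i ℙ.+ t j l) (t l i ℙ.+ t l j) ∑ℕ.⊙ 1 +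
      (i <ᵇ j) ∑ℕ.⊙ (j <ᵇ l) ∑ℕ.⊙ ((wedge i j l + wedge j i l) + wedge l i j) ≡
      (i <ᵇ j) ∑ℕ.⊙ (j <ᵇ l) ∑ℕ.⊙ 1
    pointwise i j l
      with i <ᵇ j | i ≡ᵇ j | j <ᵇ i | compare i j | j <ᵇ l | j ≡ᵇ l | l <ᵇ j | compare j l
    ... | _ | _ | _ | eq _ | _ | _ | _ | _ = refl
    ... | _ | _ | _ | gt _ | _ | _ | _ | _ = refl
    ... | _ | _ | _ | lt _ | _ | _ | _ | eq _ = refl
    ... | _ | _ | _ | lt _ | _ | _ | _ | gt _ = refl
    ... | _ | _ | _ | lt i<j | _ | _ | _ | lt j<l
      rewrite antisym (Fin.<⇒≢ i<j) | antisym (Fin.<⇒≢ j<l)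
            | antisym (Fin.<⇒≢ (Fin.<-trans i<j j<l)) = triangle (t i j) (t i l) (t j l)

  -- Vertex by vertex this is d² = 2 C(d, 2) + d: expanding the square of the sum of bits, the
  -- diagonal gives d and each wedge with that head occurs twice.
  2*wedges : 2 ℕ.* wedges + ∑ℕ.∑ (indegree t) ≡
             ∑ℕ.∑ (λ i → indegree t i ℕ.* indegree t i)
  2*wedges = begin
    2 ℕ.* wedges + ∑ℕ.∑ (indegree t)
      ≡⟨ cong (_+ ∑ℕ.∑ (indegree t)) (∑ℕ.∑-distribˡ-* 2 _) ⟩
    ∑ℕ.∑ (λ i → 2 ℕ.* w i) + ∑ℕ.∑ (indegree t)
      ≡⟨ sym (∑ℕ.∑-+ _ _) ⟩
    ∑ℕ.∑ (λ i → 2 ℕ.* w i + indegree t i)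
      ≡⟨ ∑ℕ.∑-cong (λ i → sym (square λ j → t j i)) ⟩
    ∑ℕ.∑ (λ i → indegree t i ℕ.* indegree t i) ∎
    where
    open ≡-Reasoning
    w : Fin k → ℕ
    w i = ∑ℕ.sum₂ λ j l → (j <ᵇ l) ∑ℕ.⊙ (bit (t j i) ℕ.* bit (t l i))

    bit-idem : ∀ p → bit p ℕ.* bit p ≡ bit p
    bit-idem 0ℙ = refl
    bit-idem 1ℙ = refl

    double : ∀ b x y → b ∑ℕ.⊙ (x ℕ.* y + y ℕ.* x) ≡ 2 ℕ.* (b ∑ℕ.⊙ (x ℕ.* y))
    double true  x y = symmetric x y
      where
      symmetric : ∀ x y → x ℕ.* y + y ℕ.* x ≡ 2 ℕ.* (x ℕ.* y)
      symmetric = solve-∀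
    double false x y = refl

    square : ∀ (s : Fin k → Parity) →
      ∑ℕ.∑ (bit ∘ s) ℕ.* ∑ℕ.∑ (bit ∘ s) ≡
      2 ℕ.* ∑ℕ.sum₂ (λ j l → (j <ᵇ l) ∑ℕ.⊙ (bit (s j) ℕ.* bit (s l))) + ∑ℕ.∑ (bit ∘ s)
    square s = trans (∑ℕ.∑-* _ _) (trans (∑ℕ.sum₂-split _) (cong₂ _+_
      (trans (∑ℕ.sum₂-cong λ j l → double (j <ᵇ l) (bit (s j)) (bit (s l)))
        (sym (trans (∑ℕ.∑-distribˡ-* 2 _) (∑ℕ.∑-cong λ j → ∑ℕ.∑-distribˡ-* 2 _))))
      (∑ℕ.∑-cong λ j → bit-idem (s j))))

  -- The identity E = C(k, 3) - ∑ C(d, 2) times 12, with ∑ d = C(k, 2) and the negative terms moved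
  -- across.
  12*cyclicTriangles :
    12 ℕ.* cyclicTriangles t + 6 ℕ.* ∑ℕ.∑ (λ i → indegree t i ℕ.* indegree t i)
      + 3 ℕ.* (k ℕ.* k) ≡ 2 ℕ.* (k ℕ.* (k ℕ.* k)) + k
  -- The added term completes the left sides of `6*#triples` and `2*#pairs`.
  12*cyclicTriangles = ℕ.+-cancelʳ-≡ (3 ℕ.* (k ℕ.* k) + 3 ℕ.* k) _ _ (begin
    12 ℕ.* E + 6 ℕ.* S + 3 ℕ.* (k ℕ.* k) + (3 ℕ.* (k ℕ.* k) + 3 ℕ.* k)
      ≡⟨ cong (λ s → 12 ℕ.* E + 6 ℕ.* s + 3 ℕ.* (k ℕ.* k) + (3 ℕ.* (k ℕ.* k) + 3 ℕ.* k))
              (sym (trans (cong (2 ℕ.* wedges ℕ.+_) (sym ∑-indegree)) 2*wedges)) ⟩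
    12 ℕ.* E + 6 ℕ.* (2 ℕ.* wedges + #pairs k) + 3 ℕ.* (k ℕ.* k) + (3 ℕ.* (k ℕ.* k) + 3 ℕ.* k)
      ≡⟨ regroup E wedges (#pairs k) k (k ℕ.* k) ⟩
    2 ℕ.* (6 ℕ.* (E + wedges) + 3 ℕ.* (k ℕ.* k)) + 3 ℕ.* (2 ℕ.* #pairs k + k)
      ≡⟨ cong₂ (λ x y → 2 ℕ.* x + 3 ℕ.* y)
           (trans (cong (λ x → 6 ℕ.* x + 3 ℕ.* (k ℕ.* k)) cyclicTriangles+wedges)
                  (6*#triples k)) (2*#pairs k) ⟩
    2 ℕ.* (k ℕ.* (k ℕ.* k) + 2 ℕ.* k) + 3 ℕ.* (k ℕ.* k)
      ≡⟨ final k (k ℕ.* k) (k ℕ.* (k ℕ.* k)) ⟩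
    2 ℕ.* (k ℕ.* (k ℕ.* k)) + k + (3 ℕ.* (k ℕ.* k) + 3 ℕ.* k) ∎)
    where
    open ≡-Reasoning
    E = cyclicTriangles t
    S = ∑ℕ.∑ (λ i → indegree t i ℕ.* indegree t i)
    regroup : ∀ e w p k k² →
      12 ℕ.* e + 6 ℕ.* (2 ℕ.* w + p) + 3 ℕ.* k² + (3 ℕ.* k² + 3 ℕ.* k) ≡
      2 ℕ.* (6 ℕ.* (e + w) + 3 ℕ.* k²) + 3 ℕ.* (2 ℕ.* p + k)
    regroup = solve-∀
    final : ∀ k k² k³ → 2 ℕ.* (k³ + 2 ℕ.* k) + 3 ℕ.* k² ≡
      2 ℕ.* k³ + k + (3 ℕ.* k² + 3 ℕ.* k)
    final = solve-∀

-- Latin squares of an array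

length-filter-sum : ∀ {a p} {A : Set a} {P : A → Set p} (P? : ∀ x → Dec (P x)) xs →
  length (filter P? xs) ≡ List.sum (map (λ x → does (P? x) ∑ℕ.⊙ 1) xs)
length-filter-sum P? []       = refl
length-filter-sum P? (x ∷ xs) with does (P? x)
... | true  = cong suc (length-filter-sum P? xs)
... | false = length-filter-sum P? xs

sum-mapMaybe : ∀ {a b} {A : Set a} {B : Set b} (f : A → Maybe B) (h : B → ℕ) xs →
  List.sum (map h (mapMaybe f xs)) ≡ List.sum (map (maybe′ h 0 ∘ f) xs)
sum-mapMaybe f h []       = refl
sum-mapMaybe f h (x ∷ xs) with f x
... | just y  = cong (h y ℕ.+_) (sum-mapMaybe f h xs)
... | nothing = sum-mapMaybe f h xs

sum-cartesianProduct : ∀ {a b} {A : Set a} {B : Set b} (h : A × B → ℕ) xs ys →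
  List.sum (map h (cartesianProduct xs ys)) ≡
  List.sum (map (λ x → List.sum (map (λ y → h (x , y)) ys)) xs)
sum-cartesianProduct h []       ys = refl
sum-cartesianProduct h (x ∷ xs) ys = begin
  List.sum (map h (map (x ,_) ys ++ cartesianProduct xs ys))
    ≡⟨ cong List.sum (List.map-++ h (map (x ,_) ys) _) ⟩
  List.sum (map h (map (x ,_) ys) ++ map h (cartesianProduct xs ys))
    ≡⟨ List.sum-++ (map h (map (x ,_) ys)) _ ⟩
  List.sum (map h (map (x ,_) ys)) + List.sum (map h (cartesianProduct xs ys))
    ≡⟨ cong₂ _+_ (cong List.sum (sym (List.map-∘ ys))) (sum-cartesianProduct h xs ys) ⟩
  _ ∎
  where open ≡-Reasoning

sum-tabulate : ∀ {a} {A : Set a} (h : A → ℕ) (f : Fin n → A) →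
  List.sum (map h (tabulate f)) ≡ ∑ℕ.∑ (h ∘ f)
sum-tabulate {zero}  h f = sym (∑ℕ.∑≡sum _)
sum-tabulate {suc n} h f =
  trans (cong (h (f zero) ℕ.+_) (sum-tabulate h (f ∘ suc))) (sym (∑ℕ.∑-suc _))

sum-allFin² : ∀ (h : Fin m × Fin n → ℕ) →
  List.sum (map h (cartesianProduct (allFin m) (allFin n))) ≡
  ∑ℕ.sum₂ λ i j → h (i , j)
sum-allFin² {m} {n} h = trans (sum-cartesianProduct h (allFin m) (allFin n))
  (trans (sum-tabulate _ id) (∑ℕ.∑-cong λ i → sum-tabulate (λ j → h (i , j)) id))

sum-allFin³ : ∀ (h : Fin k × Fin m × Fin n → ℕ) →
  List.sum (map h (cartesianProduct (allFin k) (cartesianProduct (allFin m) (allFin n)))) ≡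
  ∑ℕ.sum₃ λ i j l → h (i , j , l)
sum-allFin³ {k} {m} {n} h = trans
  (sum-cartesianProduct h (allFin k) (cartesianProduct (allFin m) (allFin n)))
  (trans (sum-tabulate _ id) (∑ℕ.∑-cong λ i → sum-allFin² λ jl → h (i , jl)))

-- Parities of permutations and of Latin squares

parity-inversions : ∀ (π : Permutation′ n) →
  parity π ≡ sum₂ λ i j → (i <ᵇ j) ⊙ ((π ⟨$⟩ʳ j) <ᵇ (π ⟨$⟩ʳ i)) ⊙ 1ℙ
parity-inversions {n} π = begin
  parity π
    ≡⟨ cong ℕ.parity (trans
         (length-filter-sum _ (cartesianProduct (allFin n) (allFin n))) (sum-allFin² _)) ⟩
  -- The decision used by `inversions` reduces to this conjunction, `does (i <? j)` being `i <ᵇ j`.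
  ℕ.parity (∑ℕ.sum₂ λ i j → ((i <ᵇ j) ∧ ((π ⟨$⟩ʳ j) <ᵇ (π ⟨$⟩ʳ i))) ∑ℕ.⊙ 1)
    ≡⟨ trans (parity-∑ _) (∑-cong λ i → trans (parity-∑ _)
         (∑-cong λ j → parity-∧ (i <ᵇ j) ((π ⟨$⟩ʳ j) <ᵇ (π ⟨$⟩ʳ i)))) ⟩
  (sum₂ λ i j → (i <ᵇ j) ⊙ ((π ⟨$⟩ʳ j) <ᵇ (π ⟨$⟩ʳ i)) ⊙ 1ℙ) ∎
  where
  open ≡-Reasoning
  parity-∧ : ∀ b b′ → ℕ.parity ((b ∧ b′) ∑ℕ.⊙ 1) ≡ b ⊙ b′ ⊙ 1ℙ
  parity-∧ false b′    = refl
  parity-∧ true  false = refl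
  parity-∧ true  true  = refl

module _ {a} {Λ : Set a} (e : Λ ↔ Fin n) where
  open Inverse e using (to; from)

  sumOver-parityOn : ∀ (σ : Λ → Λ ↔ Λ) →
    sumOver e (λ z → parityOn e (σ z)) ≡
    ∑ λ x → sum₂ λ y y′ → (y <ᵇ y′) ⊙
      (to (Inverse.to (σ (from x)) (from y′)) <ᵇ to (Inverse.to (σ (from x)) (from y))) ⊙ 1ℙ
  sumOver-parityOn σ = trans (sym (∑≡sum _)) (∑-cong λ x →
    parity-inversions ((e ↔-∘ σ (from x)) ↔-∘ ↔-sym e))

module ArrayColumns {a} {Λ : Set a} (e : Λ ↔ Fin n) (A : OrthogonalArray k n Λ) where
  open Inverse e using (to; from; strictlyInverseˡ; strictlyInverseʳ)
  open OrthogonalArray A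

  column : Fin k → Fin (n ^ 2) → Fin n
  column i r = to (at r i)

  column-orthogonal : ∀ {i j} → i ≢ j → Orthogonal (column i) (column j)
  column-orthogonal {i} {j} i≢j = record
    { row    = λ x y → proj₁ (o x y)
    ; u-row  = λ x y → trans (cong to (proj₁ (proj₁ (proj₂ (o x y))))) (strictlyInverseˡ x)
    ; v-row  = λ x y → trans (cong to (proj₂ (proj₁ (proj₂ (o x y))))) (strictlyInverseˡ y)
    ; unique = λ r → proj₂ (proj₂ (o (column i r) (column j r)))
                       (sym (strictlyInverseʳ _) , sym (strictlyInverseʳ _))
    }
    where
    o = λ x y → orthogonal i≢j (from x) (from y)

  module _ {i j l : Fin k} (i<j : i < j) (j<l : j < l) where
    private
      L = latinSquare A (triple i j l i<j j<l)

    -- The three parities are one formula under permutation of the columns: first the fixed column,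
    -- then the argument and the value of each permutation.
    rowParity≡ : rowParity e L ≡ discordances (column i) (column j) (column l)
    rowParity≡ = trans (sumOver-parityOn e (LatinSquare.rowPerm L))
      (sym (discordances-rows (column l) (column-orthogonal (Fin.<⇒≢ i<j))))

    colParity≡ : colParity e L ≡ discordances (column j) (column i) (column l)
    colParity≡ = trans (sumOver-parityOn e (LatinSquare.colPerm L))
      (sym (discordances-rows (column l)
        (orthogonal-sym (column-orthogonal (Fin.<⇒≢ i<j)))))

    symParity≡ : symParity e L ≡ discordances (column l) (column i) (column j)
    symParity≡ = trans (sumOver-parityOn e (LatinSquare.symPerm L))
      (sym (discordances-rows (column j)
        (orthogonal-sym (column-orthogonal (Fin.<⇒≢ (Fin.<-trans i<j j<l))))))

  -- Stated for any such `t`, since it is applied both to `arc` and to its reversal.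
  equiparityCount≡cyclicTriangles : ∀ (t : Fin k → Fin k → Parity) →
    (∀ {i j l} → i ≢ j → i ≢ l →
      discordances (column i) (column j) (column l) ≡ t i j ℙ.+ t i l) →
    equiparityCount A e ≡ cyclicTriangles t
  equiparityCount≡cyclicTriangles t discordances≡ = begin
    equiparityCount A e
      ≡⟨ length-filter-sum (equiparity? e) (map (latinSquare A) (triples k)) ⟩
    List.sum (map (λ L → does (equiparity? e L) ∑ℕ.⊙ 1) (map (latinSquare A) (triples k)))
      ≡⟨ cong List.sum (sym (List.map-∘ (triples k))) ⟩
    List.sum (map h (triples k))
      ≡⟨ sum-mapMaybe triple? h (cartesianProduct (allFin k) (cartesianProduct (allFin k) (allFin k))) ⟩
    _
      ≡⟨ sum-allFin³ {k} {k} {k} (maybe′ h 0 ∘ triple?) ⟩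
    (∑ℕ.sum₃ λ i j l → maybe′ h 0 (triple? (i , j , l)))
      ≡⟨ ∑ℕ.sum₃-cong (λ i j l → pointwise i j l (i Fin.<? j) (j Fin.<? l)) ⟩
    cyclicTriangles t ∎
    where
    open ≡-Reasoning
    h : Triple k → ℕ
    h τ = does (equiparity? e (latinSquare A τ)) ∑ℕ.⊙ 1

    equiparity≡ : ∀ {i j l} (i<j : i < j) (j<l : j < l) →
      does (equiparity? e (latinSquare A (triple i j l i<j j<l))) ≡
      all-equal (t i j ℙ.+ t i l) (t j i ℙ.+ t j l) (t l i ℙ.+ t l j)
    equiparity≡ i<j j<l
      rewrite rowParity≡ i<j j<l | colParity≡ i<j j<l | symParity≡ i<j j<l
            | discordances≡ (Fin.<⇒≢ i<j) (Fin.<⇒≢ (Fin.<-trans i<j j<l))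
            | discordances≡ (Fin.<⇒≢ i<j ∘ sym) (Fin.<⇒≢ j<l)
            | discordances≡ (Fin.<⇒≢ (Fin.<-trans i<j j<l) ∘ sym) (Fin.<⇒≢ j<l ∘ sym)
            = refl

    -- The default 0 for a triple that is not increasing matches the brackets on the right.
    pointwise : ∀ i j l (i<j? : Dec (i < j)) (j<l? : Dec (j < l)) →
      maybe′ h 0 (Maybe.map (λ (i<j , j<l) → triple i j l i<j j<l)
                            (dec⇒maybe (i<j? ×-dec j<l?))) ≡
      does i<j? ∑ℕ.⊙ does j<l? ∑ℕ.⊙
      all-equal (t i j ℙ.+ t i l) (t j i ℙ.+ t j l) (t l i ℙ.+ t l j) ∑ℕ.⊙ 1
    pointwise i j l (no _)    _         = refl
    pointwise i j l (yes _)   (no _)    = refl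
    pointwise i j l (yes i<j) (yes j<l) = cong (∑ℕ._⊙ 1) (equiparity≡ i<j j<l)

-- Arithmetic modulo 4

odd⇒1+2* : ∀ d → ℕ.parity d ≡ 1ℙ → ∃ λ h → d ≡ 1 + 2 ℕ.* h
odd⇒1+2* 1             _   = 0 , refl
odd⇒1+2* (suc (suc d)) odd with h , d≡ ← odd⇒1+2* d odd =
  suc h , trans (cong (2 ℕ.+_) d≡) (cong (1 ℕ.+_) (sym (ℕ.*-suc 2 h)))

-- For d = 2h + 1, d² = 4h(h + 1) + 1 = 8 C(h + 1, 2) + 1.
odd⇒square≡1mod8 : ∀ d → ℕ.parity d ≡ 1ℙ → ∃ λ q → d ℕ.* d ≡ 8 ℕ.* q + 1
odd⇒square≡1mod8 d odd with h , refl ← odd⇒1+2* d odd =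
  #pairs (suc h) , ℕ.+-cancelʳ-≡ (4 ℕ.* suc h) _ _ (begin
    (1 + 2 ℕ.* h) ℕ.* (1 + 2 ℕ.* h) + 4 ℕ.* suc h  ≡⟨ square h ⟩
    4 ℕ.* (suc h ℕ.* suc h) + 1
      ≡⟨ cong (λ x → 4 ℕ.* x + 1) (sym (2*#pairs (suc h))) ⟩
    4 ℕ.* (2 ℕ.* #pairs (suc h) + suc h) + 1        ≡⟨ regroup (#pairs (suc h)) h ⟩
    8 ℕ.* #pairs (suc h) + 1 + 4 ℕ.* suc h          ∎)
  where
  open ≡-Reasoning
  square : ∀ h → (1 + 2 ℕ.* h) ℕ.* (1 + 2 ℕ.* h) + 4 ℕ.* suc h ≡ 4 ℕ.* (suc h ℕ.* suc h) + 1
  square = solve-∀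
  regroup : ∀ p h → 4 ℕ.* (2 ℕ.* p + suc h) + 1 ≡ 8 ℕ.* p + 1 + 4 ℕ.* suc h
  regroup = solve-∀

-- Writing each d² as 8q + 1 turns ∑ d² into 8 ∑ q + k, and 6 · 8 = 12 · 4 absorbs the unknown ∑ q
-- into a multiple of 4 added to the count.
cyclicTriangles-odd : ∀ {t : Fin k → Fin k → Parity} → Tournament t →
  (∀ j → ∑ (λ i → t i j) ≡ 1ℙ) →
  ∃ λ q → 12 ℕ.* (cyclicTriangles t + 4 ℕ.* q) + 6 ℕ.* k + 3 ℕ.* (k ℕ.* k) ≡
          2 ℕ.* (k ℕ.* (k ℕ.* k)) + k
cyclicTriangles-odd {k} {t} T odd = ∑ℕ.∑ q , (begin
  12 ℕ.* (E + 4 ℕ.* ∑ℕ.∑ q) + 6 ℕ.* k + 3 ℕ.* (k ℕ.* k)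
    ≡⟨ regroup E (∑ℕ.∑ q) k (3 ℕ.* (k ℕ.* k)) ⟩
  12 ℕ.* E + 6 ℕ.* (8 ℕ.* ∑ℕ.∑ q + k ℕ.* 1) + 3 ℕ.* (k ℕ.* k)
    ≡⟨ cong (λ s → 12 ℕ.* E + 6 ℕ.* s + 3 ℕ.* (k ℕ.* k)) (sym squares) ⟩
  12 ℕ.* E + 6 ℕ.* ∑ℕ.∑ (λ j → indegree t j ℕ.* indegree t j) + 3 ℕ.* (k ℕ.* k)
    ≡⟨ TournamentCount.12*cyclicTriangles T ⟩
  2 ℕ.* (k ℕ.* (k ℕ.* k)) + k ∎)
  where
  open ≡-Reasoning
  E = cyclicTriangles t

  odd-indegree : ∀ j → ℕ.parity (indegree t j) ≡ 1ℙ
  odd-indegree j =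
    trans (parity-∑ _) (trans (∑-cong λ i → parity-bit (t i j)) (odd j))

  q : Fin k → ℕ
  q j = proj₁ (odd⇒square≡1mod8 (indegree t j) (odd-indegree j))

  squares : ∑ℕ.∑ (λ j → indegree t j ℕ.* indegree t j) ≡ 8 ℕ.* ∑ℕ.∑ q + k ℕ.* 1
  squares = trans
    (∑ℕ.∑-cong λ j → proj₂ (odd⇒square≡1mod8 (indegree t j) (odd-indegree j)))
    (trans (∑ℕ.∑-+ _ _)
           (cong₂ _+_ (sym (∑ℕ.∑-distribˡ-* 8 q)) (∑-const k 1)))

  regroup : ∀ e q k s → 12 ℕ.* (e + 4 ℕ.* q) + 6 ℕ.* k + s ≡
    12 ℕ.* e + 6 ℕ.* (8 ℕ.* q + k ℕ.* 1) + s
  regroup = solve-∀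

∑-1ℙ : ∀ k → ∑ {k} (λ _ → 1ℙ) ≡ ℕ.parity k
∑-1ℙ k = trans (sym (parity-∑ {k} λ _ → 1))
               (cong ℕ.parity (trans (∑-const k 1) (ℕ.*-identityʳ k)))

flip-tournament : ∀ {t : Fin k → Fin k → Parity} → Tournament t → Tournament (flip t)
flip-tournament T = record { irrefl = irrefl ; antisym = λ i≢j → antisym (i≢j ∘ sym) }
  where open Tournament T

-- Outdegree and indegree add up to k - 1, which is odd for even k.
∑-out≡⁻¹∑-in : ∀ {t : Fin k → Fin k → Parity} → Tournament t → ℕ.parity k ≡ 0ℙ →
  ∀ i → ∑ (λ j → t i j) ≡ ∑ (λ j → t j i) ℙ.⁻¹
∑-out≡⁻¹∑-in {k} {t} T even i = solve (∑ λ j → t i j) (∑ λ j → t j i) (begin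
  -- The extra 1 fills the diagonal position j = i, so that all k summands are 1.
  (∑ (λ j → t i j) ℙ.+ ∑ (λ j → t j i)) ℙ.+ 1ℙ
    ≡⟨ cong₂ ℙ._+_ (sym (∑-+ _ _)) (sym (∑-delta i λ _ → 1ℙ)) ⟩
  ∑ (λ j → t i j ℙ.+ t j i) ℙ.+ ∑ (λ j → (i ≡ᵇ j) ⊙ 1ℙ)
    ≡⟨ sym (∑-+ _ _) ⟩
  ∑ (λ j → (t i j ℙ.+ t j i) ℙ.+ (i ≡ᵇ j) ⊙ 1ℙ)
    ≡⟨ ∑-cong pointwise ⟩
  ∑ {k} (λ _ → 1ℙ)
    ≡⟨ trans (∑-1ℙ k) even ⟩
  0ℙ ∎)
  where
  open ≡-Reasoning
  open Tournament T

  solve : ∀ p q → (p ℙ.+ q) ℙ.+ 1ℙ ≡ 0ℙ → p ≡ q ℙ.⁻¹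
  solve 0ℙ 1ℙ _ = refl
  solve 1ℙ 0ℙ _ = refl

  pointwise : ∀ j → (t i j ℙ.+ t j i) ℙ.+ (i ≡ᵇ j) ⊙ 1ℙ ≡ 1ℙ
  pointwise j with i Fin.≟ j
  ... | yes refl rewrite irrefl i | ≡ᵇ-refl i = refl
  ... | no  i≢j  rewrite antisym i≢j | ≢⇒≡ᵇ-false i j i≢j =
    trans (ℙ.+-identityʳ _) (ℙ.p+p⁻¹≡1ℙ (t i j))

≡[mod4] : ∀ a b x y → a + 4 ℕ.* x ≡ b + 4 ℕ.* y → + a ≡ + b [mod 4 ]
≡[mod4] a b x y a+4x≡b+4y = ℤ.∣⇒∣ᵤ (ℤ.divides (+ y ℤ.- + x) (begin
  + a ℤ.- + b
    ≡⟨ lhs (+ a) (+ b) (+ x) ⟩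
  (+ a ℤ.+ + 4 ℤ.* + x) ℤ.- + b ℤ.- + 4 ℤ.* + x
    ≡⟨ cong (λ z → z ℤ.- + b ℤ.- + 4 ℤ.* + x) cast ⟩
  (+ b ℤ.+ + 4 ℤ.* + y) ℤ.- + b ℤ.- + 4 ℤ.* + x
    ≡⟨ rhs (+ b) (+ x) (+ y) ⟩
  (+ y ℤ.- + x) ℤ.* + 4 ∎))
  where
  open ≡-Reasoning
  cast : + a ℤ.+ + 4 ℤ.* + x ≡ + b ℤ.+ + 4 ℤ.* + y
  cast = trans (cong (λ z → + a ℤ.+ z) (sym (ℤ.pos-* 4 x)))
    (trans (cong (λ z → + z) a+4x≡b+4y) (cong (λ z → + b ℤ.+ z) (ℤ.pos-* 4 y)))

  lhs : ∀ a b x → a ℤ.- b ≡ (a ℤ.+ + 4 ℤ.* x) ℤ.- b ℤ.- + 4 ℤ.* x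
  lhs = ℤ.solve-∀

  rhs : ∀ b x y → (b ℤ.+ + 4 ℤ.* y) ℤ.- b ℤ.- + 4 ℤ.* x ≡ (y ℤ.- x) ℤ.* + 4
  rhs = ℤ.solve-∀

-- The first equation reads 12(E + 4Q) = k(k+1)(2k−5). With k + 1 = 4(m+1) or
-- k = 4(m+1) the right side is 4(m+1)(3+4V), and 3 is its own inverse modulo 4.
solve-mod4 : ∀ k m V E Q →
  12 ℕ.* (E + 4 ℕ.* Q) + 6 ℕ.* k + 3 ℕ.* (k ℕ.* k) ≡ 2 ℕ.* (k ℕ.* (k ℕ.* k)) + k →
  4 ℕ.* (suc m ℕ.* (3 + 4 ℕ.* V)) + 6 ℕ.* k + 3 ℕ.* (k ℕ.* k) ≡
    2 ℕ.* (k ℕ.* (k ℕ.* k)) + k →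
  + E ≡ + suc m [mod 4 ]
solve-mod4 k m V E Q E-eq m-eq =
  -- Adding `E + suc m` to both sides of `3E≡` makes 3E into 4E on one side and 3(m + 1) into 4(m +
  -- 1) on the other, leaving m + 1 against E.
  ≡[mod4] E (suc m) (suc m + suc m ℕ.* V) (E + 3 ℕ.* Q) (begin
    E + 4 ℕ.* (suc m + suc m ℕ.* V)        ≡⟨ lhs E m V ⟩
    (E + suc m) + suc m ℕ.* (3 + 4 ℕ.* V)  ≡⟨ cong ((E + suc m) ℕ.+_) (sym 3E≡) ⟩
    (E + suc m) + 3 ℕ.* (E + 4 ℕ.* Q)      ≡⟨ rhs E m Q ⟩
    suc m + 4 ℕ.* (E + 3 ℕ.* Q)            ∎)
  where
  open ≡-Reasoning
  3E≡ : 3 ℕ.* (E + 4 ℕ.* Q) ≡ suc m ℕ.* (3 + 4 ℕ.* V)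
  3E≡ = ℕ.*-cancelˡ-≡ _ _ 4 (trans (sym (ℕ.*-assoc 4 3 (E + 4 ℕ.* Q)))
    (ℕ.+-cancelʳ-≡ (6 ℕ.* k) _ _ (ℕ.+-cancelʳ-≡ (3 ℕ.* (k ℕ.* k)) _ _
      (trans E-eq (sym m-eq)))))
  lhs : ∀ e m v → e + 4 ℕ.* (suc m + suc m ℕ.* v) ≡ (e + suc m) + suc m ℕ.* (3 + 4 ℕ.* v)
  lhs = solve-∀
  rhs : ∀ e m q → (e + suc m) + 3 ℕ.* (e + 4 ℕ.* q) ≡ suc m + 4 ℕ.* (e + 3 ℕ.* q)
  rhs = solve-∀

-- The two residue classes of n and the final count

parity-2* : ∀ x → ℕ.parity (1 + 2 ℕ.* x) ≡ 1ℙ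
parity-2* x = trans (ℙ.+-homo-+ 1 (2 ℕ.* x)) (cong ℙ._⁻¹ (ℙ.*-homo-* 2 x))

-- The equation exhibits C(n, 2) as the odd number 1 + 2x.
pairs-odd : ∀ n x → 2 ℕ.* (1 + 2 ℕ.* x) + n ≡ n ℕ.* n → pairs n ≡ 1ℙ
pairs-odd n x eq′ = trans (sym (parity-#pairs n)) (trans
  (cong ℕ.parity (ℕ.*-cancelˡ-≡ (#pairs n) (1 + 2 ℕ.* x) 2
    (ℕ.+-cancelʳ-≡ n _ _ (trans (2*#pairs n) (sym eq′)))))
  (parity-2* x))

ceiling-/4 : ∀ r m → suc r ℕ.% 4 ≡ suc r → suc r ℕ./ 4 ≡ 0 →
             ceiling (+ (suc r + m ℕ.* 4) / 4) ≡ + suc m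
-- `ceiling` negates the floor of the negated fraction, and division of a negative integer branches
-- on the remainder; the nonzero remainder `suc r` selects the branch that increases the quotient by
-- one.
ceiling-/4 r m r%4≡r r/4≡0
  with (suc r + m ℕ.* 4) ℕ.% 4 | trans ([m+kn]%n≡m%n (suc r) m 4) r%4≡r
... | .(suc r) | refl = cong (λ q → + suc q) (trans (ℕ.+-identityʳ _)
  (trans (+-distrib-/-∣ʳ (suc r) {m ℕ.* 4} {4} (divides m refl))
         (cong₂ _+_ r/4≡0 (m*n/n≡m m 4))))

-- `δ` is the common parity of the indegrees. If they are even and k is even, the reversed
-- tournament has odd indegrees; if C(k, 2) is odd, even indegrees cannot add up to it.
equiparityCount-odd : ∀ {a} {Λ : Set a} {k} n → k ≡ suc n → pairs n ≡ 1ℙ →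
  ℕ.parity k ≡ 0ℙ ⊎ pairs k ≡ 1ℙ →
  (e : Λ ↔ Fin n) (A : OrthogonalArray k n Λ) →
  ∃ λ q → 12 ℕ.* (equiparityCount A e + 4 ℕ.* q) + 6 ℕ.* k + 3 ℕ.* (k ℕ.* k) ≡
          2 ℕ.* (k ℕ.* (k ℕ.* k)) + k
equiparityCount-odd {k = k} n refl pairs-n k-cases e A = go δ refl k-cases
  where
  open ArrayColumns e A
  open CompleteArray column column-orthogonal

  T : Tournament arc
  T = arc-tournament pairs-n

  δ : Parity
  δ = ∑ λ i → columnInversions (column i)

  -- Reversing both arcs leaves their sum modulo 2 unchanged.
  discordances≡flipped-arcs : ∀ {i j l} → i ≢ j → i ≢ l →
    discordances (column i) (column j) (column l) ≡ arc j i ℙ.+ arc l i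
  discordances≡flipped-arcs {i} {j} {l} i≢j i≢l
    rewrite Tournament.antisym T i≢j | Tournament.antisym T i≢l =
    trans (discordances≡arcs i≢j i≢l) (flips (arc i j) (arc i l))
    where
    flips : ∀ p q → p ℙ.+ q ≡ p ℙ.⁻¹ ℙ.+ q ℙ.⁻¹
    flips 0ℙ q  = sym (ℙ.⁻¹-involutive q)
    flips 1ℙ 0ℙ = refl
    flips 1ℙ 1ℙ = refl

  go : ∀ p → δ ≡ p → ℕ.parity k ≡ 0ℙ ⊎ pairs k ≡ 1ℙ →
    ∃ λ q → 12 ℕ.* (equiparityCount A e + 4 ℕ.* q) + 6 ℕ.* k + 3 ℕ.* (k ℕ.* k) ≡
            2 ℕ.* (k ℕ.* (k ℕ.* k)) + k
  go 1ℙ δ≡1 _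
    rewrite equiparityCount≡cyclicTriangles arc discordances≡arcs =
    cyclicTriangles-odd T λ j → trans (∑-arcs-into j) δ≡1
  go 0ℙ δ≡0 (inj₁ k-even)
    rewrite equiparityCount≡cyclicTriangles (flip arc) discordances≡flipped-arcs =
    cyclicTriangles-odd (flip-tournament T) λ i →
      trans (∑-out≡⁻¹∑-in T k-even i) (cong ℙ._⁻¹ (trans (∑-arcs-into i) δ≡0))
  go 0ℙ δ≡0 (inj₂ pairs-k) = ⊥-elim (0ℙ≢1ℙ (begin
    0ℙ
      ≡⟨ sym (∑-zero λ j → trans (∑-arcs-into j) δ≡0) ⟩
    (∑ λ j → ∑ λ i → arc i j)
      ≡⟨ ∑-cong (λ j → ∑-cong λ i → sym (parity-bit (arc i j))) ⟩
    (∑ λ j → ∑ λ i → ℕ.parity (bit (arc i j)))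
      ≡⟨ sym (trans (parity-∑ _) (∑-cong λ j → parity-∑ _)) ⟩
    ℕ.parity (∑ℕ.∑ (indegree arc))
      ≡⟨ cong ℕ.parity (TournamentCount.∑-indegree T) ⟩
    ℕ.parity (#pairs k)
      ≡⟨ trans (parity-#pairs k) pairs-k ⟩
    1ℙ ∎))
    where
    open ≡-Reasoning
    0ℙ≢1ℙ : 0ℙ ≢ 1ℙ
    0ℙ≢1ℙ ()

equiparityCount-mod4 : ∀ {a} {Λ : Set a} n m v → let k = n + 1 in
  pairs n ≡ 1ℙ → ℕ.parity k ≡ 0ℙ ⊎ pairs k ≡ 1ℙ →
  4 ℕ.* (suc m ℕ.* (3 + 4 ℕ.* v)) + 6 ℕ.* k + 3 ℕ.* (k ℕ.* k) ≡
    2 ℕ.* (k ℕ.* (k ℕ.* k)) + k →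
  ceiling (+ n / 4) ≡ + suc m →
  (e : Λ ↔ Fin n) (A : OrthogonalArray k n Λ) →
  + equiparityCount A e ≡ ceiling (+ n / 4) [mod 4 ]
equiparityCount-mod4 n m v pairs-n k-cases m-eq ceiling≡ e A
  with q , E-eq ← equiparityCount-odd n (ℕ.+-comm n 1) pairs-n k-cases e A =
  subst (+ equiparityCount A e ≡_[mod 4 ]) (sym ceiling≡)
    (solve-mod4 (n + 1) m v (equiparityCount A e) q E-eq m-eq)

theorem6p8 : ∀ {a} (n : ℕ) → 2 ≤ n → (+ n ≡ + 2 [mod 4 ]) ⊎ (+ n ≡ + 3 [mod 4 ]) →
    (Λ : Set a) (e : Λ ↔ Fin n) (A : OrthogonalArray (n + 1) n Λ) →
    + equiparityCount A e ≡ ceiling (+ n / 4) [mod 4 ]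
theorem6p8 (suc zero) (ℕ.s≤s ())
theorem6p8 (suc (suc _)) _ (inj₁ (divides m refl)) Λ e A =
  -- Here k = 4m + 3, and (4m + 3)(8m + 1) = 3 + 4(8m² + 7m) gives the third argument.
  equiparityCount-mod4 (2 + m ℕ.* 4) m (8 ℕ.* (m ℕ.* m) + 7 ℕ.* m)
    (pairs-odd (2 + m ℕ.* 4) (4 ℕ.* (m ℕ.* m) + 3 ℕ.* m) (pairs-n m))
    (inj₂ (pairs-odd (2 + m ℕ.* 4 + 1) (4 ℕ.* (m ℕ.* m) + 5 ℕ.* m + 1) (pairs-k m)))
    (identity m) (ceiling-/4 1 m refl refl) e A
  where
  pairs-n : ∀ m → 2 ℕ.* (1 + 2 ℕ.* (4 ℕ.* (m ℕ.* m) + 3 ℕ.* m)) + (2 + m ℕ.* 4) ≡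
    (2 + m ℕ.* 4) ℕ.* (2 + m ℕ.* 4)
  pairs-n = solve-∀

  pairs-k : ∀ m → 2 ℕ.* (1 + 2 ℕ.* (4 ℕ.* (m ℕ.* m) + 5 ℕ.* m + 1)) + (2 + m ℕ.* 4 + 1) ≡
    (2 + m ℕ.* 4 + 1) ℕ.* (2 + m ℕ.* 4 + 1)
  pairs-k = solve-∀

  identity : ∀ m →
    4 ℕ.* (suc m ℕ.* (3 + 4 ℕ.* (8 ℕ.* (m ℕ.* m) + 7 ℕ.* m)))
      + 6 ℕ.* (2 + m ℕ.* 4 + 1) + 3 ℕ.* ((2 + m ℕ.* 4 + 1) ℕ.* (2 + m ℕ.* 4 + 1)) ≡
    2 ℕ.* ((2 + m ℕ.* 4 + 1) ℕ.* ((2 + m ℕ.* 4 + 1) ℕ.* (2 + m ℕ.* 4 + 1)))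
      + (2 + m ℕ.* 4 + 1)
  identity = solve-∀
-- For n = 2 the distance to 3 is 1, not a multiple of 4; from n = 3 on, n - 3 is a natural number.
theorem6p8 (suc (suc zero)) _ (inj₂ (divides zero ()))
theorem6p8 (suc (suc zero)) _ (inj₂ (divides (suc _) ()))
theorem6p8 (suc (suc (suc _))) _ (inj₂ (divides m refl)) Λ e A =
  -- Here k = 4m + 4, and (4m + 5)(8m + 3) = 3 + 4(8m² + 13m + 3).
  equiparityCount-mod4 (3 + m ℕ.* 4) m (8 ℕ.* (m ℕ.* m) + 13 ℕ.* m + 3)
    (pairs-odd (3 + m ℕ.* 4) (4 ℕ.* (m ℕ.* m) + 5 ℕ.* m + 1) (pairs-n m))
    (inj₁ (trans (cong ℕ.parity (k-even m)) (ℙ.*-homo-* 2 (2 ℕ.* suc m))))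
    (identity m) (ceiling-/4 2 m refl refl) e A
  where
  pairs-n : ∀ m → 2 ℕ.* (1 + 2 ℕ.* (4 ℕ.* (m ℕ.* m) + 5 ℕ.* m + 1)) + (3 + m ℕ.* 4) ≡
    (3 + m ℕ.* 4) ℕ.* (3 + m ℕ.* 4)
  pairs-n = solve-∀

  k-even : ∀ m → 3 + m ℕ.* 4 + 1 ≡ 2 ℕ.* (2 ℕ.* suc m)
  k-even = solve-∀

  identity : ∀ m →
    4 ℕ.* (suc m ℕ.* (3 + 4 ℕ.* (8 ℕ.* (m ℕ.* m) + 13 ℕ.* m + 3)))
      + 6 ℕ.* (3 + m ℕ.* 4 + 1) + 3 ℕ.* ((3 + m ℕ.* 4 + 1) ℕ.* (3 + m ℕ.* 4 + 1)) ≡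
    2 ℕ.* ((3 + m ℕ.* 4 + 1) ℕ.* ((3 + m ℕ.* 4 + 1) ℕ.* (3 + m ℕ.* 4 + 1)))
      + (3 + m ℕ.* 4 + 1)
  identity = solve-∀
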